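{- The polynomials $\{\mathrm{BoNa}_n(u)\}_{n\ge 2}$, where $\mathrm{BoNa}_n(u)=\sum_{k=1}^n \mathrm{BoNa}(n,k)u^k$, have weakly interlacing roots. More precisely, each polynomial $\mathrm{BoNa}_n(u)$ has a root at $0$, and the nonzero roots of $\mathrm{BoNa}_{n-1}(u)$ strictly interlace the nonzero roots of $\mathrm{BoNa}_n(u)$.
   Context: A binary plane tree is a rooted plane tree on unlabeled vertices in which every non-leaf vertex has one or two children, and every child is a left child or a right child, even if it is the only child of its parent. A 0-1-tree is a binary plane tree in which every vertex that has two children is labeled 0 or 1 (no other vertex is labeled). A right edge is an edge connecting a vertex to its right child. For $n\ge 1$, the Boolean-Narayana number $\mathrm{BoNa}(n,k)$ is the number of 0-1-trees on $n$ vertices that have exactly $k-1$ right edges. "Weakly interlacing roots" has here the meaning given by the "More precisely" sentence: consecutive polynomials share the root $0$, and their nonzero roots strictly interlace. The nonzero roots of $\mathrm{BoNa}_{n-1}(u)$ strictly interlace those of $\mathrm{BoNa}_n(u)$ if all these roots are real and, listing the nonzero roots (with multiplicity) of $\mathrm{BoNa}_n$ as $x_1,\ldots,x_{n-1}$ and those of $\mathrm{BoNa}_{n-1}$ as $y_1,\ldots,y_{n-2}$ in increasing order, one has $x_1<y_1<x_2<y_2<\cdots<y_{n-2}<x_{n-1}$. -}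

module Defs where

open import Data.Fin.Base using (Fin; inject₁) renaming (zero to fzero; suc to fsuc)
open import Data.Integer.Base using (+_)
open import Data.List.Base
  using (List; []; _∷_; _++_; map; filter; length; applyUpTo; cartesianProductWith)
open import Data.List.Membership.Propositional using (_∈_)
open import Data.List.Membership.Propositional.Properties
  using (∈-map⁺; ∈-map⁻; ∈-++⁺ˡ; ∈-++⁺ʳ; ∈-++⁻; ∈-filter⁺; ∈-filter⁻;
         ∈-cartesianProductWith⁺; ∈-cartesianProductWith⁻)
open import Data.List.Relation.Binary.Disjoint.Propositional using (Disjoint)
open import Data.List.Relation.Unary.All as All using ()
open import Data.List.Relation.Unary.AllPairs using ([]; _∷_)
open import Data.List.Relation.Unary.Any using (here; there)
open import Data.List.Relation.Unary.Unique.Propositional using (Unique)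
import Data.List.Relation.Unary.Unique.Propositional.Properties as Unique
open import Data.Nat.Base as ℕ using (ℕ; zero; suc; s≤s; _⊔_)
import Data.Nat.Properties as ℕₚ
open import Data.Product.Base using (_×_; _,_; proj₁; proj₂; Σ-syntax; ∃-syntax)
open import Data.Rational.Base as ℚ
  using (ℚ; 0ℚ; 1ℚ; ½; _/_; _+_; _*_; -_; _-_; ∣_∣; _<_; 1/_; Positive; positive; NonZero)
open import Data.Rational.Properties as ℚₚ using ()
open import Data.Rational.Solver using (module +-*-Solver)
open import Data.Sum.Base using (_⊎_; inj₁; inj₂)
open import Data.Vec.Base as Vec using (Vec; lookup; toList)
open import Data.Vec.Relation.Unary.All as VecAll using ()
open import Relation.Binary.PropositionalEquality
  using (_≡_; refl; sym; trans; cong; cong₂; subst)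
open import Relation.Nullary.Decidable using (Dec; _×-dec_)

data ZeroOneTree : Set where
  leaf  : ZeroOneTree
  left  : ZeroOneTree → ZeroOneTree
  right : ZeroOneTree → ZeroOneTree
  both  : (label : Fin 2) (l r : ZeroOneTree) → ZeroOneTree

vertices : ZeroOneTree → ℕ
vertices leaf         = 1
vertices (left t)     = suc (vertices t)
vertices (right t)    = suc (vertices t)
vertices (both _ l r) = suc (vertices l ℕ.+ vertices r)

rightEdges : ZeroOneTree → ℕ
rightEdges leaf         = 0
rightEdges (left t)     = rightEdges t
rightEdges (right t)    = suc (rightEdges t)
rightEdges (both _ l r) = suc (rightEdges l ℕ.+ rightEdges r)

-- Each tree with at most h levels of vertices occurs exactly once.
treesOfHeight≤ : ℕ → List ZeroOneTree
treesOfHeight≤ zero    = []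
treesOfHeight≤ (suc h) =
  leaf ∷ map left ts ++ map right ts
       ++ cartesianProductWith (both fzero) ts ts
       ++ cartesianProductWith (both (fsuc fzero)) ts ts
  where ts = treesOfHeight≤ h

-- `k - 1 right edges' is written so that no tree qualifies when k = 0.
HasShape : ℕ → ℕ → ZeroOneTree → Set
HasShape n k t = vertices t ≡ n × suc (rightEdges t) ≡ k

hasShape? : ∀ n k t → Dec (HasShape n k t)
hasShape? n k t = (vertices t ℕₚ.≟ n) ×-dec (suc (rightEdges t) ℕₚ.≟ k)

-- A tree on n vertices has at most n levels, so the bound n loses nothing;
-- see zeroOneTrees-complete and zeroOneTrees-unique.
zeroOneTrees : ℕ → ℕ → List ZeroOneTree
zeroOneTrees n k = filter (hasShape? n k) (treesOfHeight≤ n)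

BoNa : ℕ → ℕ → ℕ
BoNa n k = length (zeroOneTrees n k)

treesOfHeight≤-complete : ∀ h t → vertices t ℕ.≤ h → t ∈ treesOfHeight≤ h
treesOfHeight≤-complete (suc h) leaf _ = here refl
treesOfHeight≤-complete (suc h) (left t) (s≤s p) =
  there (∈-++⁺ˡ (∈-map⁺ left (treesOfHeight≤-complete h t p)))
treesOfHeight≤-complete (suc h) (right t) (s≤s p) =
  there (∈-++⁺ʳ (map left (treesOfHeight≤ h))
    (∈-++⁺ˡ (∈-map⁺ right (treesOfHeight≤-complete h t p))))
treesOfHeight≤-complete (suc h) (both b l r) (s≤s p) =
  there (∈-++⁺ʳ (map left ts) (∈-++⁺ʳ (map right ts) (go b)))
  where
  ts  = treesOfHeight≤ h
  l∈ : l ∈ ts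
  l∈ = treesOfHeight≤-complete h l (ℕₚ.≤-trans (ℕₚ.m≤m+n (vertices l) (vertices r)) p)
  r∈ : r ∈ ts
  r∈ = treesOfHeight≤-complete h r (ℕₚ.≤-trans (ℕₚ.m≤n+m (vertices r) (vertices l)) p)
  go : ∀ b → both b l r ∈ cartesianProductWith (both fzero) ts ts
                       ++ cartesianProductWith (both (fsuc fzero)) ts ts
  go fzero        = ∈-++⁺ˡ (∈-cartesianProductWith⁺ (both fzero) l∈ r∈)
  go (fsuc fzero) = ∈-++⁺ʳ (cartesianProductWith (both fzero) ts ts)
                           (∈-cartesianProductWith⁺ (both (fsuc fzero)) l∈ r∈)

treesOfHeight≤-unique : ∀ h → Unique (treesOfHeight≤ h)
treesOfHeight≤-unique zero    = []
treesOfHeight≤-unique (suc h) =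
  All.tabulate leaf∉ ∷
  Unique.++⁺ (Unique.map⁺ (λ { refl → refl }) ts!)
    (Unique.++⁺ (Unique.map⁺ (λ { refl → refl }) ts!)
      (Unique.++⁺ (prod! fzero) (prod! (fsuc fzero)) 0∩1)
      right∩both)
    left∩rest
  where
  ts = treesOfHeight≤ h
  ts! = treesOfHeight≤-unique h
  P : Fin 2 → List ZeroOneTree
  P b = cartesianProductWith (both b) ts ts
  prod! : ∀ b → Unique (P b)
  prod! b = Unique.cartesianProductWith⁺ (both b) (λ { refl → refl , refl }) ts! ts!
  isBoth : ∀ {t} → t ∈ P fzero ++ P (fsuc fzero) →
           ∃[ b ] ∃[ l ] ∃[ r ] t ≡ both b l r
  isBoth t∈ with ∈-++⁻ (P fzero) t∈
  ... | inj₁ q with l , r , _ , _ , e ← ∈-cartesianProductWith⁻ (both fzero) ts ts q =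
    fzero , l , r , e
  ... | inj₂ q with l , r , _ , _ , e ← ∈-cartesianProductWith⁻ (both (fsuc fzero)) ts ts q =
    fsuc fzero , l , r , e
  0∩1 : Disjoint (P fzero) (P (fsuc fzero))
  0∩1 (p , q)
    with ∈-cartesianProductWith⁻ (both fzero) ts ts p
       | ∈-cartesianProductWith⁻ (both (fsuc fzero)) ts ts q
  ... | _ , _ , _ , _ , refl | _ , _ , _ , _ , ()
  right∩both : Disjoint (map right ts) (P fzero ++ P (fsuc fzero))
  right∩both (p , q) with ∈-map⁻ right p | isBoth q
  ... | _ , _ , refl | _ , _ , _ , ()
  left∩rest : Disjoint (map left ts) (map right ts ++ P fzero ++ P (fsuc fzero))
  left∩rest (p , q) with ∈-map⁻ left p | ∈-++⁻ (map right ts) q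
  ... | _ , _ , refl | inj₁ q′ with () ← proj₂ (proj₂ (∈-map⁻ right q′))
  left∩rest (p , q) | _ , _ , refl | inj₂ q′ with _ , _ , _ , () ← isBoth q′
  leaf∉ : ∀ {t} → t ∈ map left ts ++ map right ts ++ P fzero ++ P (fsuc fzero) →
          leaf ≡ t → _
  leaf∉ t∈ refl with ∈-++⁻ (map left ts) t∈
  ... | inj₁ q with () ← proj₂ (proj₂ (∈-map⁻ left q))
  ... | inj₂ q with ∈-++⁻ (map right ts) q
  ...   | inj₁ q′ with () ← proj₂ (proj₂ (∈-map⁻ right q′))
  ...   | inj₂ q′ with _ , _ , _ , () ← isBoth q′

zeroOneTrees-sound : ∀ {n k t} → t ∈ zeroOneTrees n k → HasShape n k t
zeroOneTrees-sound {n} {k} t∈ =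
  proj₂ (∈-filter⁻ (hasShape? n k) {xs = treesOfHeight≤ n} t∈)

zeroOneTrees-complete : ∀ {n k t} → HasShape n k t → t ∈ zeroOneTrees n k
zeroOneTrees-complete {n} {k} {t} s@(refl , _) =
  ∈-filter⁺ (hasShape? n k) (treesOfHeight≤-complete n t ℕₚ.≤-refl) s

zeroOneTrees-unique : ∀ n k → Unique (zeroOneTrees n k)
zeroOneTrees-unique n k = Unique.filter⁺ (hasShape? n k) (treesOfHeight≤-unique n)

-- Real numbers are Cauchy sequences of rationals, taken up to _≃_.
IsCauchy : (ℕ → ℚ) → Set
IsCauchy x = ∀ ε → 0ℚ < ε →
  ∃[ N ] (∀ m n → N ℕ.≤ m → N ℕ.≤ n → ∣ x m - x n ∣ < ε)

record ℝ : Set where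
  constructor mkℝ
  field
    seq    : ℕ → ℚ
    cauchy : IsCauchy seq

open ℝ public

infix 4 _≃_ _<ᴿ_ _#_

_≃_ : ℝ → ℝ → Set
x ≃ y = ∀ ε → 0ℚ < ε →
  ∃[ N ] (∀ n → N ℕ.≤ n → ∣ seq x n - seq y n ∣ < ε)

-- A fixed positive rational gap is required: termwise _<_ would not survive
-- passing to the limit.
_<ᴿ_ : ℝ → ℝ → Set
x <ᴿ y = ∃[ ε ] 0ℚ < ε × ∃[ N ] (∀ n → N ℕ.≤ n → seq x n + ε < seq y n)

-- The constructive form of x ≠ y; classically the two are equivalent.
_#_ : ℝ → ℝ → Set
x # y = x <ᴿ y ⊎ y <ᴿ x

fromℚ : ℚ → ℝ
fromℚ q = mkℝ (λ _ → q) λ ε 0<ε →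
  0 , λ _ _ _ _ → subst (_< ε) (sym (cong ∣_∣ (ℚₚ.+-inverseʳ q))) 0<ε

fromℕ : ℕ → ℝ
fromℕ n = fromℚ (+ n / 1)

0ᴿ 1ᴿ : ℝ
0ᴿ = fromℕ 0
1ᴿ = fromℕ 1

private
  open +-*-Solver using (solve; _:=_; _:+_; _:*_; _:-_; :-_; con)

  sub-add : ∀ a b → a ≡ (a - b) + b
  sub-add = solve 2 (λ a b → a := (a :- b) :+ b) refl

  add-split : ∀ a b c d → (a + b) - (c + d) ≡ (a - c) + (b - d)
  add-split = solve 4 (λ a b c d → (a :+ b) :- (c :+ d) := (a :- c) :+ (b :- d)) refl

  neg-split : ∀ a b → - (a - b) ≡ (- a) - (- b)
  neg-split = solve 2 (λ a b → :- (a :- b) := (:- a) :- (:- b)) refl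

  half>0 : ∀ {ε} → 0ℚ < ε → 0ℚ < ε * ½
  half>0 {ε} 0<ε =
    ℚₚ.positive⁻¹ _ {{ℚₚ.pos*pos⇒pos ε {{positive 0<ε}} ½}}

  halves : ∀ ε → ε * ½ + ε * ½ ≡ ε
  halves ε = trans (sym (ℚₚ.*-distribˡ-+ ε ½ ½)) (ℚₚ.*-identityʳ ε)

  shrink : ∀ B ε → 0ℚ < B → 0ℚ < ε → ∃[ δ ] 0ℚ < δ × B * δ ≡ ε
  shrink B ε 0<B 0<ε =
    B⁻¹ * ε ,
    ℚₚ.positive⁻¹ _ {{ℚₚ.pos*pos⇒pos B⁻¹ {{ℚₚ.1/pos⇒pos B}} ε {{positive 0<ε}}}} ,
    trans (sym (ℚₚ.*-assoc B B⁻¹ ε))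
      (trans (cong (_* ε) (ℚₚ.*-inverseʳ B)) (ℚₚ.*-identityˡ ε))
    where
    instance
      B>0 : Positive B
      B>0 = positive 0<B
      B≢0 : NonZero B
      B≢0 = ℚₚ.pos⇒nonZero B
    B⁻¹ = 1/ B

  eventuallyBounded : ∀ x → IsCauchy x →
    ∃[ B ] 0ℚ < B × ∃[ N ] (∀ n → N ℕ.≤ n → ∣ x n ∣ < B)
  eventuallyBounded x cx with cx 1ℚ (ℚₚ.positive⁻¹ 1ℚ)
  ... | N , h = 1ℚ + ∣ x N ∣ ,
    ℚₚ.+-mono-<-≤ (ℚₚ.positive⁻¹ 1ℚ) (ℚₚ.0≤∣p∣ (x N)) ,
    N , λ n N≤n → begin-strict
      ∣ x n ∣                 ≡⟨ cong ∣_∣ (sub-add (x n) (x N)) ⟩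
      ∣ (x n - x N) + x N ∣   ≤⟨ ℚₚ.∣p+q∣≤∣p∣+∣q∣ (x n - x N) (x N) ⟩
      ∣ x n - x N ∣ + ∣ x N ∣ <⟨ ℚₚ.+-monoˡ-< ∣ x N ∣ (h n N N≤n ℕₚ.≤-refl) ⟩
      1ℚ + ∣ x N ∣            ∎
    where open ℚₚ.≤-Reasoning

  -- Everything below looks only at seq; unfolding these moduli is very slow.
  abstract
    +-cauchy : ∀ x y → IsCauchy x → IsCauchy y → IsCauchy (λ n → x n + y n)
    +-cauchy x y cx cy ε 0<ε with cx (ε * ½) (half>0 0<ε) | cy (ε * ½) (half>0 0<ε)
    ... | M , f | N , g = M ⊔ N , λ m n p q → begin-strict
        ∣ (x m + y m) - (x n + y n) ∣   ≡⟨ cong ∣_∣ (add-split (x m) (y m) (x n) (y n)) ⟩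
        ∣ (x m - x n) + (y m - y n) ∣   ≤⟨ ℚₚ.∣p+q∣≤∣p∣+∣q∣ (x m - x n) (y m - y n) ⟩
        ∣ x m - x n ∣ + ∣ y m - y n ∣   <⟨ ℚₚ.+-mono-< (f m n (ℕₚ.m⊔n≤o⇒m≤o M N p) (ℕₚ.m⊔n≤o⇒m≤o M N q))
                                                       (g m n (ℕₚ.m⊔n≤o⇒n≤o M N p) (ℕₚ.m⊔n≤o⇒n≤o M N q)) ⟩
        ε * ½ + ε * ½                   ≡⟨ halves ε ⟩
        ε                               ∎
      where open ℚₚ.≤-Reasoning

    neg-cauchy : ∀ x → IsCauchy x → IsCauchy (λ n → - x n)
    neg-cauchy x cx ε 0<ε with cx ε 0<ε
    ... | N , f = N , λ m n p q →
      subst (_< ε)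
        (trans (sym (ℚₚ.∣-p∣≡∣p∣ (x m - x n)))
               (cong ∣_∣ (neg-split (x m) (x n))))
        (f m n p q)

    mul-bound : ∀ u v C η → 0ℚ < C → ∣ u ∣ < C → ∣ v ∣ < η → ∣ u * v ∣ < C * η
    mul-bound u v C η 0<C u<C v<η = begin-strict
        ∣ u * v ∣     ≡⟨ ℚₚ.∣p*q∣≡∣p∣*∣q∣ u v ⟩
        ∣ u ∣ * ∣ v ∣ ≤⟨ ℚₚ.*-monoʳ-≤-nonNeg ∣ v ∣ {{ℚₚ.∣-∣-nonNeg v}} (ℚₚ.<⇒≤ u<C) ⟩
        C * ∣ v ∣     <⟨ ℚₚ.*-monoʳ-<-pos C {{positive 0<C}} v<η ⟩
        C * η         ∎
      where open ℚₚ.≤-Reasoning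

    mul-split : ∀ a b c d → a * b - c * d ≡ a * (b - d) + d * (a - c)
    mul-split = solve 4 (λ a b c d → a :* b :- c :* d := a :* (b :- d) :+ d :* (a :- c)) refl

    mul-close : ∀ a b c d A B δ γ → 0ℚ < A → 0ℚ < B →
      ∣ a ∣ < A → ∣ d ∣ < B → ∣ b - d ∣ < δ → ∣ a - c ∣ < γ →
      ∣ a * b - c * d ∣ < A * δ + B * γ
    mul-close a b c d A B δ γ 0<A 0<B a<A d<B b~d a~c = begin-strict
        ∣ a * b - c * d ∣                   ≡⟨ cong ∣_∣ (mul-split a b c d) ⟩
        ∣ a * (b - d) + d * (a - c) ∣       ≤⟨ ℚₚ.∣p+q∣≤∣p∣+∣q∣ (a * (b - d)) (d * (a - c)) ⟩
        ∣ a * (b - d) ∣ + ∣ d * (a - c) ∣   <⟨ ℚₚ.+-mono-< (mul-bound a (b - d) A δ 0<A a<A b~d)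
                                                           (mul-bound d (a - c) B γ 0<B d<B a~c) ⟩
        A * δ + B * γ                       ∎
      where open ℚₚ.≤-Reasoning

    *-cauchy : ∀ x y → IsCauchy x → IsCauchy y → IsCauchy (λ n → x n * y n)
    *-cauchy x y cx cy ε 0<ε =
      let A , 0<A , M₁ , a = eventuallyBounded x cx
          B , 0<B , M₂ , b = eventuallyBounded y cy
          δ , 0<δ , Aδ = shrink A (ε * ½) 0<A (half>0 0<ε)
          γ , 0<γ , Bγ = shrink B (ε * ½) 0<B (half>0 0<ε)
          N₁ , f = cx γ 0<γ
          N₂ , g = cy δ 0<δ
      in combine A B δ γ M₁ M₂ N₁ N₂ 0<A 0<B a b f g
           (trans (cong₂ _+_ Aδ Bγ) (halves ε))
      where
      combine : ∀ A B δ γ M₁ M₂ N₁ N₂ → 0ℚ < A → 0ℚ < B →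
        (∀ n → M₁ ℕ.≤ n → ∣ x n ∣ < A) → (∀ n → M₂ ℕ.≤ n → ∣ y n ∣ < B) →
        (∀ m n → N₁ ℕ.≤ m → N₁ ℕ.≤ n → ∣ x m - x n ∣ < γ) →
        (∀ m n → N₂ ℕ.≤ m → N₂ ℕ.≤ n → ∣ y m - y n ∣ < δ) →
        A * δ + B * γ ≡ ε →
        ∃[ N ] (∀ m n → N ℕ.≤ m → N ℕ.≤ n → ∣ x m * y m - x n * y n ∣ < ε)
      combine A B δ γ M₁ M₂ N₁ N₂ 0<A 0<B a b f g eq =
        (M₁ ⊔ M₂) ⊔ (N₁ ⊔ N₂) , λ m n p q →
          subst (∣ x m * y m - x n * y n ∣ <_) eq
            (mul-close (x m) (y m) (x n) (y n) A B δ γ 0<A 0<B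
              (a m (M₁≤ p)) (b n (M₂≤ q))
              (g m n (N₂≤ p) (N₂≤ q)) (f m n (N₁≤ p) (N₁≤ q)))
        where
        M₁≤ : ∀ {k} → (M₁ ⊔ M₂) ⊔ (N₁ ⊔ N₂) ℕ.≤ k → M₁ ℕ.≤ k
        M₁≤ p = ℕₚ.m⊔n≤o⇒m≤o M₁ M₂ (ℕₚ.m⊔n≤o⇒m≤o (M₁ ⊔ M₂) (N₁ ⊔ N₂) p)
        M₂≤ : ∀ {k} → (M₁ ⊔ M₂) ⊔ (N₁ ⊔ N₂) ℕ.≤ k → M₂ ℕ.≤ k
        M₂≤ p = ℕₚ.m⊔n≤o⇒n≤o M₁ M₂ (ℕₚ.m⊔n≤o⇒m≤o (M₁ ⊔ M₂) (N₁ ⊔ N₂) p)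
        N₁≤ : ∀ {k} → (M₁ ⊔ M₂) ⊔ (N₁ ⊔ N₂) ℕ.≤ k → N₁ ℕ.≤ k
        N₁≤ p = ℕₚ.m⊔n≤o⇒m≤o N₁ N₂ (ℕₚ.m⊔n≤o⇒n≤o (M₁ ⊔ M₂) (N₁ ⊔ N₂) p)
        N₂≤ : ∀ {k} → (M₁ ⊔ M₂) ⊔ (N₁ ⊔ N₂) ℕ.≤ k → N₂ ℕ.≤ k
        N₂≤ p = ℕₚ.m⊔n≤o⇒n≤o N₁ N₂ (ℕₚ.m⊔n≤o⇒n≤o (M₁ ⊔ M₂) (N₁ ⊔ N₂) p)

infixl 6 _+ᴿ_
infixl 7 _*ᴿ_
infix  8 -ᴿ_

_+ᴿ_ : ℝ → ℝ → ℝ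
x +ᴿ y = mkℝ (λ n → seq x n + seq y n) (+-cauchy (seq x) (seq y) (cauchy x) (cauchy y))

-ᴿ_ : ℝ → ℝ
-ᴿ x = mkℝ (λ n → - seq x n) (neg-cauchy (seq x) (cauchy x))

_*ᴿ_ : ℝ → ℝ → ℝ
x *ᴿ y = mkℝ (λ n → seq x n * seq y n) (*-cauchy (seq x) (seq y) (cauchy x) (cauchy y))

-- Coefficient lists, constant term first; trailing zeros are allowed.
Poly : Set
Poly = List ℝ

coeff : Poly → ℕ → ℝ
coeff []      _       = 0ᴿ
coeff (a ∷ p) zero    = a
coeff (a ∷ p) (suc i) = coeff p i

infix  4 _≋_
infixl 6 _+ₚ_
infixl 7 _*ₚ_ _·ₚ_
infixr 8 _^ₚ_

_≋_ : Poly → Poly → Set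
p ≋ q = ∀ i → coeff p i ≃ coeff q i

eval : Poly → ℝ → ℝ
eval []      u = 0ᴿ
eval (a ∷ p) u = a +ᴿ u *ᴿ eval p u

_+ₚ_ : Poly → Poly → Poly
[]      +ₚ q       = q
(a ∷ p) +ₚ []      = a ∷ p
(a ∷ p) +ₚ (b ∷ q) = a +ᴿ b ∷ p +ₚ q

_·ₚ_ : ℝ → Poly → Poly
c ·ₚ p = map (c *ᴿ_) p

_*ₚ_ : Poly → Poly → Poly
[]      *ₚ q = []
(a ∷ p) *ₚ q = a ·ₚ q +ₚ (0ᴿ ∷ p *ₚ q)

1ₚ : Poly
1ₚ = 1ᴿ ∷ []

u-_ : ℝ → Poly
u- a = -ᴿ a ∷ 1ᴿ ∷ []

_^ₚ_ : Poly → ℕ → Poly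
p ^ₚ zero  = 1ₚ
p ^ₚ suc m = p *ₚ p ^ₚ m

∏[u-_] : ∀ {d} → Vec ℝ d → Poly
∏[u- xs ] = Vec.foldr′ (λ x p → (u- x) *ₚ p) 1ₚ xs

IsRoot : Poly → ℝ → Set
IsRoot p x = eval p x ≃ 0ᴿ

-- All complex roots of p are real, and xs lists the nonzero ones with
-- multiplicity: p = c (u - 0)^m (u - x₁) ⋯ (u - x_d) with c, x₁, …, x_d nonzero.
record NonzeroRoots {d} (p : Poly) (xs : Vec ℝ d) : Set where
  field
    leading       : ℝ
    leading#0     : leading # 0ᴿ
    multiplicity₀ : ℕ
    nonzero       : VecAll.All (_# 0ᴿ) xs
    factorisation : p ≋ leading ·ₚ ((u- 0ᴿ) ^ₚ multiplicity₀ *ₚ ∏[u- xs ])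

-- x₁ < y₁ < x₂ < y₂ < ⋯ < y_d < x_{d+1}
StrictlyAlternate : ∀ {d} → Vec ℝ d → Vec ℝ (suc d) → Set
StrictlyAlternate {d} ys xs = ∀ (i : Fin d) →
  lookup xs (inject₁ i) <ᴿ lookup ys i × lookup ys i <ᴿ lookup xs (fsuc i)

-- The d nonzero roots of q strictly interlace the d + 1 nonzero roots of p.
NonzeroRootsStrictlyInterlace : ℕ → Poly → Poly → Set
NonzeroRootsStrictlyInterlace d q p =
  Σ[ ys ∈ Vec ℝ d ] Σ[ xs ∈ Vec ℝ (suc d) ]
    NonzeroRoots q ys × NonzeroRoots p xs × StrictlyAlternate ys xs

-- BoNa_n(u) = Σ_{k=1}^n BoNa(n,k) u^k: constant term 0, then k = 1, …, n.
BoNaPoly : ℕ → Poly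
BoNaPoly n = 0ᴿ ∷ applyUpTo (λ i → fromℕ (BoNa n (suc i))) n

{-# OPTIONS --safe #-}

module Submission where

-- Let b_n(u) = BoNa_n(u) / u.  The decomposition of a tree at its root says that
-- B = Σ b_n z^n satisfies B = z (1 + (1 + u) B + 2 u B²).  Differentiating gives
-- the three-term recurrence
--   (n + 3) b_{n+2} = (2 n + 3) (1 + u) b_{n+1} - n (u² - 6 u + 1) b_n,
-- and u² - 6 u + 1 > 0 for u < 0.  Hence at a (negative) root of b_{n+1} the values
-- of b_{n+2} and b_n have opposite signs.  If the roots of b_n and b_{n+1} interlace,
-- the signs of b_{n+2} therefore alternate along -∞, the roots of b_{n+1}, and 0, and
-- the intermediate value theorem yields roots of b_{n+2} strictly between these points.
-- Constructively, bisection is possible because the b_n have rational coefficients: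
-- a strict sign at a real point persists at nearby rational points, and signs at
-- rational points are decidable.

open import Defs

open import Algebra.Bundles using (CommutativeRing; CommutativeSemiring)
import Algebra.Properties.Group as GroupProperties
import Algebra.Properties.Semiring.Mult as Mult
import Algebra.Solver.Ring.NaturalCoefficients.Default as SemiringSolver
open import Algebra.Structures.Biased using (isCommutativeSemiringˡ)
open import Data.Bool.Base using (Bool; true; false; if_then_else_; _∧_) renaming (T to IsTrue)
open import Data.Fin.Base using () renaming (zero to fzero; suc to fsuc)
open import Data.Integer.Base as ℤ using ()
import Data.Integer.Properties as ℤₚ
open import Data.List.Base
  using (List; []; _∷_; _++_; map; filter; length; foldr; applyUpTo; cartesianProductWith)
open import Data.List.Membership.Propositional using (_∈_)
open import Data.List.Properties using (length-applyUpTo)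
open import Data.List.Relation.Unary.Any using (here; there)
open import Data.Nat.Base as ℕ using (ℕ; zero; suc; _≤_; _∸_; z≤n; s≤s; _⊔_; _≡ᵇ_)
import Data.Nat.Properties as ℕₚ
open import Data.Product.Base using (_×_; _,_; proj₁; proj₂; ∃-syntax)
import Data.Rational.Base as ℚ
import Data.Rational.Properties as ℚₚ
import Data.Rational.Solver as ℚSolver
import Data.Rational.Unnormalised.Base as ℚᵘ
import Data.Rational.Unnormalised.Properties as ℚᵘₚ
open import Data.Sum.Base using (inj₁; inj₂)
open import Data.Unit.Base using (⊤; tt)
open import Data.Vec.Base using (Vec; []; _∷_)
open import Data.Vec.Relation.Unary.All as VecAll using ([]; _∷_)
open import Function.Base using (_∘_)
import Relation.Binary.PropositionalEquality as ≡
open import Relation.Binary.Structures using (IsEquivalence)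
import Relation.Binary.Reasoning.Setoid as SetoidReasoning
open import Relation.Nullary.Decidable using (does; yes; no)

-- The generating function of 0-1-trees

-- The counting keeps `u` fixed, as an element of an arbitrary commutative ring: the generating
-- function is a power series in `z` alone, and the recurrence is an identity between values, later
-- used at every rational approximation of a root. Trees are listed by height because raising the
-- height bound by one is exactly one application of a quadratic map, and the coefficient of z^n no
-- longer changes once the bound has reached n.
--
-- The signs of b_n at the roots of b_{n+1} are carried along the induction. Once the roots of
-- b_{n+2} are found, the signs of b_{n+1} at them follow from the factorisation of b_{n+1} into
-- linear factors; the factorisation thus serves the induction as well as the statement.
--
-- Real roots enter only through their approximating sequences. An equation becomes a sequence
-- tending to 0, a strict inequality a sequence eventually above a positive bound, and algebraic
-- identities are applied term by term over the rationals.

module TreeWeights {c ℓ} (S : CommutativeSemiring c ℓ)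
                   (z u : CommutativeSemiring.Carrier S) where
  open CommutativeSemiring S
  open SemiringSolver S using (solve; _:=_; _:+_; _:*_; con)
  open SetoidReasoning setoid

  -- In the intended instance this is z^(vertices) u^(right edges), see `weight≈monomial`. The
  -- recursive form makes the totals of the lists of trees factor.
  weight : ZeroOneTree → Carrier
  weight leaf         = z
  weight (left t)     = z * weight t
  weight (right t)    = z * (u * weight t)
  weight (both _ l r) = z * (u * (weight l * weight r))

  total : List ZeroOneTree → Carrier
  total = foldr (λ t x → weight t + x) 0#

  total-++ : ∀ ts ts′ → total (ts ++ ts′) ≈ total ts + total ts′
  total-++ []       ts′ = sym (+-identityˡ _)
  total-++ (t ∷ ts) ts′ = trans (+-congˡ (total-++ ts ts′)) (sym (+-assoc _ _ _))

  total-map : ∀ f k → (∀ t → weight (f t) ≈ k * weight t) →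
              ∀ ts → total (map f ts) ≈ k * total ts
  total-map f k f-scales []       = sym (zeroʳ k)
  total-map f k f-scales (t ∷ ts) =
    trans (+-cong (f-scales t) (total-map f k f-scales ts)) (sym (distribˡ _ _ _))

  total-product : ∀ b ts ts′ →
    total (cartesianProductWith (both b) ts ts′) ≈ z * (u * (total ts * total ts′))
  total-product b []       ts′ =
    solve 3 (λ z u x → con 0 := z :* (u :* (con 0 :* x))) refl z u (total ts′)
  total-product b (t ∷ ts) ts′ = begin
    total (map (both b t) ts′ ++ cartesianProductWith (both b) ts ts′)
      ≈⟨ total-++ (map (both b t) ts′) _ ⟩
    total (map (both b t) ts′) + total (cartesianProductWith (both b) ts ts′)
      ≈⟨ +-cong (total-map (both b t) (z * (u * weight t)) scales ts′)
                (total-product b ts ts′) ⟩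
    z * (u * weight t) * total ts′ + z * (u * (total ts * total ts′))
      ≈⟨ solve 5 (λ z u w x y → z :* (u :* w) :* y :+ z :* (u :* (x :* y)) :=
                                z :* (u :* ((w :+ x) :* y)))
               refl z u (weight t) (total ts) (total ts′) ⟩
    z * (u * ((weight t + total ts) * total ts′)) ∎
    where
    scales : ∀ r → z * (u * (weight t * weight r)) ≈ z * (u * weight t) * weight r
    scales r = solve 4 (λ z u w x → z :* (u :* (w :* x)) := z :* (u :* w) :* x)
                     refl z u (weight t) (weight r)

  -- The factor `u + u` counts the two labels of a root with two children, which always has one
  -- right edge.
  quadratic : Carrier → Carrier
  quadratic G = z * (1# + (1# + u) * G + (u + u) * (G * G))

  total-treesOfHeight≤ : ∀ h →
    total (treesOfHeight≤ (suc h)) ≈ quadratic (total (treesOfHeight≤ h))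
  total-treesOfHeight≤ h = begin
    z + total (map left ts ++ map right ts ++ P₀ ++ P₁)
      ≈⟨ +-congˡ (trans (total-++ (map left ts) _)
          (+-congˡ (trans (total-++ (map right ts) _) (+-congˡ (total-++ P₀ P₁))))) ⟩
    z + (total (map left ts) + (total (map right ts) + (total P₀ + total P₁)))
      ≈⟨ +-congˡ (+-cong (total-map left z (λ _ → refl) ts)
          (+-cong (total-map right (z * u) (λ _ → sym (*-assoc _ _ _)) ts)
            (+-cong (total-product _ ts ts) (total-product _ ts ts)))) ⟩
    z + (z * G + (z * u * G + (z * (u * (G * G)) + z * (u * (G * G)))))
      ≈⟨ solve 3 (λ z u G →
           z :+ (z :* G :+ (z :* u :* G :+ (z :* (u :* (G :* G)) :+ z :* (u :* (G :* G))))) :=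
           z :* (con 1 :+ (con 1 :+ u) :* G :+ (u :+ u) :* (G :* G))) refl z u G ⟩
    quadratic G ∎
    where
    ts = treesOfHeight≤ h
    P₀ = cartesianProductWith (both fzero) ts ts
    P₁ = cartesianProductWith (both (fsuc fzero)) ts ts
    G  = total ts

-- Formal power series over a commutative semiring

module PowerSeries {c ℓ} (R : CommutativeSemiring c ℓ) where
  open CommutativeSemiring R
  open Mult semiring using () renaming (_×_ to _ℕ×_)
  open SemiringSolver R using (solve; _:=_; _:+_; _:*_; con)
  open SetoidReasoning setoid

  Series : Set c
  Series = ℕ → Carrier

  infix  4 _≈ₛ_
  infixl 6 _⊕_
  infixl 7 _⊛_

  _≈ₛ_ : Series → Series → Set ℓ
  a ≈ₛ b = ∀ n → a n ≈ b n

  _⊕_ : Series → Series → Series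
  (a ⊕ b) n = a n + b n

  -- The Cauchy product, splitting the left factor as a 0 + z (a ∘ suc). Finite sums are avoided,
  -- and the semiring laws follow by induction on the degree.
  _⊛_ : Series → Series → Series
  (a ⊛ b) zero    = a 0 * b 0
  (a ⊛ b) (suc n) = a 0 * b (suc n) + (a ∘ suc ⊛ b) n

  monomial : Carrier → ℕ → Series
  monomial k zero    zero    = k
  monomial k zero    (suc n) = 0#
  monomial k (suc m) zero    = 0#
  monomial k (suc m) (suc n) = monomial k m n

  0ₛ 1ₛ z : Series
  0ₛ _ = 0#
  1ₛ   = monomial 1# 0
  z    = monomial 1# 1

  const : Carrier → Series
  const k = monomial k 0

  -- This locality is what lets two totals that agree only in low degrees have products that agree
  -- there.
  ⊛-cong-≤ : ∀ n {a a′ b b′} → (∀ i → i ≤ n → a i ≈ a′ i) → (∀ i → i ≤ n → b i ≈ b′ i) →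
             (a ⊛ b) n ≈ (a′ ⊛ b′) n
  ⊛-cong-≤ zero    p q = *-cong (p 0 z≤n) (q 0 z≤n)
  ⊛-cong-≤ (suc n) p q = +-cong (*-cong (p 0 z≤n) (q (suc n) ℕₚ.≤-refl))
    (⊛-cong-≤ n (λ i i≤n → p (suc i) (s≤s i≤n)) (λ i i≤n → q i (ℕₚ.m≤n⇒m≤1+n i≤n)))

  ⊛-cong : ∀ {a a′ b b′} → a ≈ₛ a′ → b ≈ₛ b′ → a ⊛ b ≈ₛ a′ ⊛ b′
  ⊛-cong p q n = ⊛-cong-≤ n (λ i _ → p i) (λ i _ → q i)

  ⊛-zeroˡ : ∀ b → 0ₛ ⊛ b ≈ₛ 0ₛ
  ⊛-zeroˡ b zero    = zeroˡ _
  ⊛-zeroˡ b (suc n) = trans (+-cong (zeroˡ _) (⊛-zeroˡ b n)) (+-identityˡ _)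

  ⊛-distribʳ : ∀ c a b → (a ⊕ b) ⊛ c ≈ₛ a ⊛ c ⊕ b ⊛ c
  ⊛-distribʳ c a b zero    = distribʳ _ _ _
  ⊛-distribʳ c a b (suc n) = trans (+-congˡ (⊛-distribʳ c (a ∘ suc) (b ∘ suc) n))
    (solve 5 (λ x y w p q → (x :+ y) :* w :+ (p :+ q) := x :* w :+ p :+ (y :* w :+ q))
      refl (a 0) (b 0) (c (suc n)) ((a ∘ suc ⊛ c) n) ((b ∘ suc ⊛ c) n))

  ⊛-scaleˡ : ∀ k a b n → ((λ i → k * a i) ⊛ b) n ≈ k * (a ⊛ b) n
  ⊛-scaleˡ k a b zero    = *-assoc _ _ _
  ⊛-scaleˡ k a b (suc n) = trans (+-cong (*-assoc _ _ _) (⊛-scaleˡ k (a ∘ suc) b n))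
                                 (sym (distribˡ _ _ _))

  -- The mirror image of the defining recursion, peeling the right factor; commutativity rests on
  -- it.
  ⊛-sucʳ : ∀ a b n → (a ⊛ b) (suc n) ≈ (a ⊛ b ∘ suc) n + a (suc n) * b 0
  ⊛-sucʳ a b zero    = refl
  ⊛-sucʳ a b (suc n) = trans (+-congˡ (⊛-sucʳ (a ∘ suc) b n)) (sym (+-assoc _ _ _))

  ⊛-comm : ∀ a b → a ⊛ b ≈ₛ b ⊛ a
  ⊛-comm a b zero    = *-comm _ _
  ⊛-comm a b (suc n) = begin
    a 0 * b (suc n) + (a ∘ suc ⊛ b) n  ≈⟨ +-cong (*-comm _ _) (⊛-comm (a ∘ suc) b n) ⟩
    b (suc n) * a 0 + (b ⊛ a ∘ suc) n  ≈⟨ +-comm _ _ ⟩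
    (b ⊛ a ∘ suc) n + b (suc n) * a 0  ≈⟨ ⊛-sucʳ b a n ⟨
    (b ⊛ a) (suc n)                    ∎

  ⊛-assoc : ∀ a b c → (a ⊛ b) ⊛ c ≈ₛ a ⊛ (b ⊛ c)
  ⊛-assoc a b c zero    = *-assoc _ _ _
  ⊛-assoc a b c (suc n) = begin
    a 0 * b 0 * c (suc n) + (((λ i → a 0 * b (suc i)) ⊕ (a ∘ suc ⊛ b)) ⊛ c) n
      ≈⟨ +-congˡ (⊛-distribʳ c _ (a ∘ suc ⊛ b) n) ⟩
    a 0 * b 0 * c (suc n) + (((λ i → a 0 * b (suc i)) ⊛ c) n + ((a ∘ suc ⊛ b) ⊛ c) n)
      ≈⟨ +-congˡ (+-cong (⊛-scaleˡ (a 0) (b ∘ suc) c n) (⊛-assoc (a ∘ suc) b c n)) ⟩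
    a 0 * b 0 * c (suc n) + (a 0 * (b ∘ suc ⊛ c) n + (a ∘ suc ⊛ (b ⊛ c)) n)
      ≈⟨ solve 5 (λ x y w p q → x :* y :* w :+ (x :* p :+ q) := x :* (y :* w :+ p) :+ q)
               refl (a 0) (b 0) (c (suc n)) ((b ∘ suc ⊛ c) n) ((a ∘ suc ⊛ (b ⊛ c)) n) ⟩
    a 0 * (b ⊛ c) (suc n) + (a ∘ suc ⊛ (b ⊛ c)) n ∎

  const-⊛ : ∀ k b n → (const k ⊛ b) n ≈ k * b n
  const-⊛ k b zero    = refl
  const-⊛ k b (suc n) = trans (+-congˡ (⊛-zeroˡ b n)) (+-identityʳ _)

  ⊛-identityˡ : ∀ b → 1ₛ ⊛ b ≈ₛ b
  ⊛-identityˡ b n = trans (const-⊛ 1# b n) (*-identityˡ _)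

  z-⊛-zero : ∀ b → (z ⊛ b) 0 ≈ 0#
  z-⊛-zero b = zeroˡ _

  z-⊛-suc : ∀ b n → (z ⊛ b) (suc n) ≈ b n
  z-⊛-suc b n = trans (+-cong (zeroˡ _) (⊛-identityˡ b n)) (+-identityˡ _)

  monomial-⊛ : ∀ k m k′ m′ → monomial k m ⊛ monomial k′ m′ ≈ₛ monomial (k * k′) (m ℕ.+ m′)
  monomial-⊛ k zero k′ m′ n = trans (const-⊛ k (monomial k′ m′) n) (scale m′ n)
    where
    scale : ∀ m n → k * monomial k′ m n ≈ monomial (k * k′) m n
    scale zero    zero    = refl
    scale zero    (suc n) = zeroʳ k
    scale (suc m) zero    = zeroʳ k
    scale (suc m) (suc n) = scale m n
  monomial-⊛ k (suc m) k′ m′ zero    = zeroˡ _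
  monomial-⊛ k (suc m) k′ m′ (suc n) =
    trans (+-cong (zeroˡ _) (monomial-⊛ k m k′ m′ n)) (+-identityˡ _)

  -- Makes the semiring solver and `TreeWeights` applicable to series.
  seriesSemiring : CommutativeSemiring c ℓ
  seriesSemiring = record
    { Carrier = Series ; _≈_ = _≈ₛ_ ; _+_ = _⊕_ ; _*_ = _⊛_ ; 0# = 0ₛ ; 1# = 1ₛ
    ; isCommutativeSemiring = isCommutativeSemiringˡ record
      { +-isCommutativeMonoid = record
        { isMonoid = record
          { isSemigroup = record
            { isMagma = record
              { isEquivalence = isEquivalenceₛ
              ; ∙-cong = λ p q n → +-cong (p n) (q n) }
            ; assoc = λ a b c n → +-assoc _ _ _ }
          ; identity = (λ a n → +-identityˡ _) , (λ a n → +-identityʳ _) }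
        ; comm = λ a b n → +-comm _ _ }
      ; *-isCommutativeMonoid = record
        { isMonoid = record
          { isSemigroup = record
            { isMagma = record { isEquivalence = isEquivalenceₛ ; ∙-cong = ⊛-cong }
            ; assoc = ⊛-assoc }
          ; identity = ⊛-identityˡ , (λ a n → trans (⊛-comm a 1ₛ n) (⊛-identityˡ a n)) }
        ; comm = ⊛-comm }
      ; distribʳ = ⊛-distribʳ
      ; zeroˡ = ⊛-zeroˡ } }
    where
    isEquivalenceₛ : IsEquivalence _≈ₛ_
    isEquivalenceₛ = record
      { refl = λ n → refl ; sym = λ p n → sym (p n) ; trans = λ p q n → trans (p n) (q n) }

  -- z d/dz
  θ : Series → Series
  θ a n = (n ℕ× 1#) * a n

  -- The Leibniz rule. Dropping the constant term lowers all indices by one, so `θ` of the tail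
  -- lacks one copy of the tail (`θ-tail`); the summand `1#` of `1# + ν` supplies it.
  θ-⊛ : ∀ a b → θ (a ⊛ b) ≈ₛ θ a ⊛ b ⊕ a ⊛ θ b
  θ-⊛ a b zero    = solve 2 (λ x y → con 0 :* (x :* y) := con 0 :* x :* y :+ x :* (con 0 :* y))
                          refl (a 0) (b 0)
  θ-⊛ a b (suc n) = begin
    (1# + ν) * (a 0 * b (suc n) + C)
      ≈⟨ solve 4 (λ ν x y w → (con 1 :+ ν) :* (x :* y :+ w) :=
                              x :* ((con 1 :+ ν) :* y) :+ (w :+ ν :* w))
               refl ν (a 0) (b (suc n)) C ⟩
    a 0 * θ b (suc n) + (C + θ (a ∘ suc ⊛ b) n)
      ≈⟨ +-congˡ (+-congˡ (θ-⊛ (a ∘ suc) b n)) ⟩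
    a 0 * θ b (suc n) + (C + ((θ (a ∘ suc) ⊛ b) n + (a ∘ suc ⊛ θ b) n))
      ≈⟨ solve 6 (λ x y w p q s → x :* y :+ (w :+ (p :+ q)) :=
                                con 0 :* s :* y :+ (w :+ p) :+ (x :* y :+ q))
               refl (a 0) (θ b (suc n)) C ((θ (a ∘ suc) ⊛ b) n) ((a ∘ suc ⊛ θ b) n) (a 0) ⟩
    0# * a 0 * θ b (suc n) + (C + (θ (a ∘ suc) ⊛ b) n) + (a ⊛ θ b) (suc n)
      ≈⟨ +-congʳ (+-cong
           (solve 3 (λ x y w → con 0 :* x :* y := con 0 :* x :* w) refl (a 0) (θ b (suc n)) (b (suc n)))
           (trans (sym (⊛-distribʳ b (a ∘ suc) (θ (a ∘ suc)) n)) (⊛-cong θ-tail (λ _ → refl) n))) ⟩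
    (θ a ⊛ b) (suc n) + (a ⊛ θ b) (suc n) ∎
    where
    ν = n ℕ× 1#
    C = (a ∘ suc ⊛ b) n
    θ-tail : a ∘ suc ⊕ θ (a ∘ suc) ≈ₛ θ a ∘ suc
    θ-tail i = solve 2 (λ x ν → x :+ ν :* x := (con 1 :+ ν) :* x) refl (a (suc i)) (i ℕ× 1#)

  θ-const : ∀ k → θ (const k) ≈ₛ 0ₛ
  θ-const k zero    = zeroˡ _
  θ-const k (suc n) = zeroʳ _

  θ-z : θ z ≈ₛ z
  θ-z zero          = zeroˡ _
  θ-z (suc zero)    = trans (*-identityʳ _) (+-identityʳ _)
  θ-z (suc (suc n)) = zeroʳ _

-- The series of all 0-1-trees and its recurrence

module TreeSeries {c ℓ} (R : CommutativeRing c ℓ) (u : CommutativeRing.Carrier R) where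
  open CommutativeRing R
  open PowerSeries commutativeSemiring
  open Mult semiring using () renaming (_×_ to _ℕ×_)
  open SetoidReasoning setoid
  open SemiringSolver commutativeSemiring using () renaming
    (solve to solve′; _:=_ to _:=′_; _:+_ to _:+′_; _:*_ to _:*′_; con to con′)
  private module S = CommutativeSemiring seriesSemiring
  open SemiringSolver seriesSemiring using (solve; _:=_; _:+_; _:*_; con)
  open TreeWeights seriesSemiring z (const u)

  p : Carrier
  p = 1# + u

  totalOfHeight≤ : ℕ → Series
  totalOfHeight≤ h = total (treesOfHeight≤ h)

  -- The diagonal replaces a limit over heights: by `total≈b`, coefficient n is the same for every
  -- height bound from n on.
  b : Series
  b n = totalOfHeight≤ n n

  step : Series → Series
  step G n = 1ₛ n + p * G n + (u + u) * (G ⊛ G) n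

  quadratic-suc : ∀ G n → quadratic G (suc n) ≈ step G n
  quadratic-suc G n = begin
    quadratic G (suc n)
      ≈⟨ z-⊛-suc (1ₛ ⊕ (1ₛ ⊕ const u) ⊛ G ⊕ (const u ⊕ const u) ⊛ (G ⊛ G)) n ⟩
    1ₛ n + ((1ₛ ⊕ const u) ⊛ G) n + ((const u ⊕ const u) ⊛ (G ⊛ G)) n
      ≈⟨ +-cong (+-congˡ (trans (⊛-cong (const-+ 1# u) (λ _ → refl) n) (const-⊛ p G n)))
                (trans (⊛-cong (const-+ u u) (λ _ → refl) n) (const-⊛ (u + u) (G ⊛ G) n)) ⟩
    step G n ∎
    where
    const-+ : ∀ x y → const x ⊕ const y ≈ₛ const (x + y)
    const-+ x y zero    = refl
    const-+ x y (suc n) = +-identityʳ _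

  step-cong-≤ : ∀ n {G G′} → (∀ i → i ≤ n → G i ≈ G′ i) → step G n ≈ step G′ n
  step-cong-≤ n e = +-cong (+-congˡ (*-congˡ (e n ℕₚ.≤-refl))) (*-congˡ (⊛-cong-≤ n e e))

  total-suc : ∀ h n → totalOfHeight≤ (suc h) (suc n) ≈ step (totalOfHeight≤ h) n
  total-suc h n = trans (total-treesOfHeight≤ h (suc n)) (quadratic-suc (totalOfHeight≤ h) n)

  quadratic-zero : ∀ G → quadratic G 0 ≈ 0#
  quadratic-zero G = z-⊛-zero (1ₛ ⊕ (1ₛ ⊕ const u) ⊛ G ⊕ (const u ⊕ const u) ⊛ (G ⊛ G))

  total-zero : ∀ h → totalOfHeight≤ h 0 ≈ 0#
  total-zero zero    = refl
  total-zero (suc h) =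
    trans (total-treesOfHeight≤ h 0) (quadratic-zero (totalOfHeight≤ h))

  -- Coefficient n + 1 on either side is `step` of the total one level lower, and `step` at n reads
  -- only coefficients up to n.
  total-stable : ∀ h n → n ≤ h → totalOfHeight≤ (suc h) n ≈ totalOfHeight≤ h n
  total-stable h       zero    _         = trans (total-zero (suc h)) (sym (total-zero h))
  total-stable (suc h) (suc n) (s≤s n≤h) = begin
    totalOfHeight≤ (suc (suc h)) (suc n)  ≈⟨ total-suc (suc h) n ⟩
    step (totalOfHeight≤ (suc h)) n
      ≈⟨ step-cong-≤ n (λ i i≤n → total-stable h i (ℕₚ.≤-trans i≤n n≤h)) ⟩
    step (totalOfHeight≤ h) n             ≈⟨ total-suc h n ⟨
    totalOfHeight≤ (suc h) (suc n)        ∎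

  total≈b : ∀ h n → n ≤ h → totalOfHeight≤ h n ≈ b n
  total≈b zero    zero    _ = refl
  total≈b (suc h) n       n≤1+h with ℕₚ.m≤n⇒m<n∨m≡n n≤1+h
  ... | inj₁ (s≤s n≤h) = trans (total-stable h n n≤h) (total≈b h n n≤h)
  ... | inj₂ ≡.refl    = refl

  b-suc : ∀ n → b (suc n) ≈ step b n
  b-suc n = trans (total-suc n n) (step-cong-≤ n (total≈b n))

  b-quadratic : b ≈ₛ quadratic b
  b-quadratic zero    = sym (quadratic-zero b)
  b-quadratic (suc n) = trans (b-suc n) (sym (quadratic-suc b n))

  -- Additive inverses of `R` enter here: the solver works in a semiring of series, so subtraction
  -- is replaced by adding terms to both sides and cancelling them.
  ⊕-cancelʳ : ∀ a {x y} → x ⊕ a ≈ₛ y ⊕ a → x ≈ₛ y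
  ⊕-cancelʳ a {x} {y} e n = GroupProperties.∙-cancelʳ +-group (a n) (x n) (y n) (e n)

  private
    U = const u
    P = 1ₛ ⊕ U
    Θ = θ b
    -- The derivative of `quadratic` with respect to its argument, taken at `b`.
    T = P ⊛ z ⊕ (U ⊕ U ⊕ U ⊕ U) ⊛ (z ⊛ b)

  -- θ applied to b-quadratic, in which b-quadratic itself absorbs the terms without Θ.
  θb-linear : Θ ≈ₛ b ⊕ T ⊛ Θ
  θb-linear = S.trans (S.trans (λ n → *-congˡ (b-quadratic n)) (S.trans (θ-⊛ z _)
      (S.+-cong (⊛-cong θ-z (λ _ → refl)) (⊛-cong {z} {z} (λ _ → refl) θ-inner))))
    (S.trans (solve 4 (λ z u b Θ →
        z :* (con 1 :+ (con 1 :+ u) :* b :+ (u :+ u) :* (b :* b)) :+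
        z :* ((con 1 :+ u) :* Θ :+ (u :+ u) :* (Θ :* b :+ b :* Θ)) :=
        z :* (con 1 :+ (con 1 :+ u) :* b :+ (u :+ u) :* (b :* b)) :+
        ((con 1 :+ u) :* z :+ (u :+ u :+ u :+ u) :* (z :* b)) :* Θ)
      S.refl z U b Θ)
     (S.+-congʳ {T ⊛ Θ} (S.sym b-quadratic)))
    where
    θ-⊕ : ∀ x y → θ (x ⊕ y) ≈ₛ θ x ⊕ θ y
    θ-⊕ x y n = distribˡ _ _ _
    θ-1 : θ 1ₛ ≈ₛ 0ₛ
    θ-1 = θ-const 1#
    θ-scale : ∀ k x → θ k ≈ₛ 0ₛ → θ (k ⊛ x) ≈ₛ k ⊛ θ x
    θ-scale k x e = S.trans (θ-⊛ k x)
      (S.trans (S.+-congʳ {k ⊛ θ x} (S.trans (⊛-cong e (λ _ → refl)) (⊛-zeroˡ x))) (S.+-identityˡ _))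
    θ-sum : ∀ x y → θ x ≈ₛ 0ₛ → θ y ≈ₛ 0ₛ → θ (x ⊕ y) ≈ₛ 0ₛ
    θ-sum x y e f = S.trans (θ-⊕ x y) (S.trans (S.+-cong e f) (S.+-identityˡ _))
    θ-inner : θ (1ₛ ⊕ P ⊛ b ⊕ (U ⊕ U) ⊛ (b ⊛ b)) ≈ₛ P ⊛ Θ ⊕ (U ⊕ U) ⊛ (Θ ⊛ b ⊕ b ⊛ Θ)
    θ-inner = S.trans (θ-⊕ (1ₛ ⊕ P ⊛ b) ((U ⊕ U) ⊛ (b ⊛ b))) (S.+-cong
      (S.trans (θ-⊕ 1ₛ (P ⊛ b)) (S.trans
        (S.+-cong θ-1 (θ-scale P b (θ-sum 1ₛ U θ-1 (θ-const u)))) (S.+-identityˡ _)))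
      (S.trans (θ-scale (U ⊕ U) (b ⊛ b) (θ-sum U U (θ-const u) (θ-const u)))
        (S.*-congˡ {U ⊕ U} (θ-⊛ b b))))

  -- With T = (1 + u) z + 4 u z b this is (1 - T)² Θ = (1 - T) b, where b-quadratic turns
  -- (1 - T)² into the discriminant (1 - (1 + u) z)² - 8 u z².  All terms are moved so
  -- that no subtraction occurs: it is then a semiring identity up to cancellation.
  b-ode : Θ ⊕ b ⊕ P ⊛ (P ⊛ (z ⊛ (z ⊛ Θ))) ≈ₛ
          (P ⊕ P) ⊛ (z ⊛ Θ) ⊕ (U ⊕ U ⊕ U ⊕ U ⊕ U ⊕ U ⊕ U ⊕ U) ⊛ (z ⊛ (z ⊛ Θ)) ⊕ P ⊛ (z ⊛ b) ⊕ (z ⊕ z)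
  b-ode = ⊕-cancelʳ (T ⊛ Θ ⊕ b ⊕ T ⊛ Θ ⊕ K ⊛ f ⊕ (f ⊕ f))
    (S.trans
      (solve 4 (λ z u b Θ →
        let P = con 1 :+ u
            U4 = u :+ u :+ u :+ u
            T = P :* z :+ U4 :* (z :* b)
            K = (U4 :+ U4) :* (z :* Θ)
            f = z :* (con 1 :+ P :* b :+ (u :+ u) :* (b :* b))
        in Θ :+ b :+ P :* (P :* (z :* (z :* Θ))) :+ (T :* Θ :+ b :+ T :* Θ :+ K :* f :+ (f :+ f)) :=
           (P :+ P) :* (z :* Θ) :+ (u :+ u :+ u :+ u :+ u :+ u :+ u :+ u) :* (z :* (z :* Θ))
           :+ P :* (z :* b) :+ (z :+ z) :+ (Θ :+ T :* (b :+ T :* Θ) :+ K :* b :+ (b :+ b)))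
        S.refl z U b Θ)
      (S.+-congˡ {RHS} (S.+-cong (S.+-cong (S.+-cong
          (S.trans θb-linear (S.+-comm b (T ⊛ Θ))) (S.*-congˡ {T} (S.sym θb-linear)))
          (S.*-congˡ {K} b-quadratic)) (S.+-cong b-quadratic b-quadratic))))
    where
    f = quadratic b
    -- The multiples of `b-quadratic` are chosen to eliminate the powers of `b`: `K` times it
    -- removes the b² Θ term of T² Θ, and twice it removes the b² term of T b.
    K = (U ⊕ U ⊕ U ⊕ U ⊕ (U ⊕ U ⊕ U ⊕ U)) ⊛ (z ⊛ Θ)
    RHS = (P ⊕ P) ⊛ (z ⊛ Θ) ⊕ (U ⊕ U ⊕ U ⊕ U ⊕ U ⊕ U ⊕ U ⊕ U) ⊛ (z ⊛ (z ⊛ Θ)) ⊕ P ⊛ (z ⊛ b) ⊕ (z ⊕ z)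

  -- Coefficient of z^(n+2) in b-ode.
  recurrence : ∀ n → let ν = n ℕ× 1# in
    (1# + (1# + ν)) * b (2 ℕ.+ n) + b (2 ℕ.+ n) + p * (p * (ν * b n)) ≈
    (p + p) * ((1# + ν) * b (1 ℕ.+ n)) + (u + u + u + u + u + u + u + u) * (ν * b n) + p * b (1 ℕ.+ n)
  recurrence n = begin
    Θ (2 ℕ.+ n) + b (2 ℕ.+ n) + p * (p * Θ n)
      ≈⟨ +-congˡ (trans (P-⊛ (P ⊛ (z ⊛ (z ⊛ Θ))) (2 ℕ.+ n)) (*-congˡ (trans (P-⊛ (z ⊛ (z ⊛ Θ)) (2 ℕ.+ n))
           (*-congˡ (z²-⊛ Θ))))) ⟨
    (Θ ⊕ b ⊕ P ⊛ (P ⊛ (z ⊛ (z ⊛ Θ)))) (2 ℕ.+ n)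
      ≈⟨ b-ode (2 ℕ.+ n) ⟩
    ((P ⊕ P) ⊛ (z ⊛ Θ) ⊕ U8 ⊛ (z ⊛ (z ⊛ Θ)) ⊕ P ⊛ (z ⊛ b) ⊕ (z ⊕ z)) (2 ℕ.+ n)
      ≈⟨ +-cong (+-cong (+-cong
           (trans (constant-⊛ {p + p} {P ⊕ P} refl
                    (λ i → trans (+-cong (+-identityˡ _) (+-identityˡ _)) (+-identityˡ _)) (z ⊛ Θ) (2 ℕ.+ n))
                  (*-congˡ (z-⊛-suc Θ (1 ℕ.+ n))))
           (trans (constant-⊛ {u8} {U8} refl (λ i → solve′ 0
                    (o :+′ o :+′ o :+′ o :+′ o :+′ o :+′ o :+′ o :=′ o) refl) (z ⊛ (z ⊛ Θ)) (2 ℕ.+ n))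
                  (*-congˡ (z²-⊛ Θ))))
           (trans (P-⊛ (z ⊛ b) (2 ℕ.+ n)) (*-congˡ (z-⊛-suc b (1 ℕ.+ n)))))
           -- The inhomogeneous term `z ⊕ z` lives in degree 1 only.
           (+-identityˡ _) ⟩
    (p + p) * Θ (1 ℕ.+ n) + u8 * Θ n + p * b (1 ℕ.+ n) + 0#
      ≈⟨ +-identityʳ _ ⟩
    (p + p) * Θ (1 ℕ.+ n) + u8 * Θ n + p * b (1 ℕ.+ n) ∎
    where
    o  = con′ 0
    u8 = u + u + u + u + u + u + u + u
    U8 = U ⊕ U ⊕ U ⊕ U ⊕ U ⊕ U ⊕ U ⊕ U
    constant-⊛ : ∀ {k K} → K 0 ≈ k → (∀ i → K (suc i) ≈ 0#) → ∀ x i → (K ⊛ x) i ≈ k * x i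
    constant-⊛ {k} {K} e f x i = trans (⊛-cong K≈k (λ _ → refl) i) (const-⊛ k x i)
      where
      K≈k : K ≈ₛ const k
      K≈k zero    = e
      K≈k (suc i) = f i
    P-⊛ : ∀ x i → (P ⊛ x) i ≈ p * x i
    P-⊛ = constant-⊛ {p} {P} refl (λ i → +-identityˡ _)
    z²-⊛ : ∀ x → (z ⊛ (z ⊛ x)) (2 ℕ.+ n) ≈ x n
    z²-⊛ x = trans (z-⊛-suc (z ⊛ x) (1 ℕ.+ n)) (z-⊛-suc x n)

  -- Values of the counting polynomials as coefficients of the series

  evalUpTo : (ℕ → Carrier) → ℕ → Carrier
  evalUpTo c zero    = 0#
  evalUpTo c (suc n) = c 0 + u * evalUpTo (c ∘ suc) n

  evalUpTo-cong : ∀ {c d} n → (∀ i → c i ≈ d i) → evalUpTo c n ≈ evalUpTo d n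
  evalUpTo-cong zero    e = refl
  evalUpTo-cong (suc n) e = +-cong (e 0) (*-congˡ (evalUpTo-cong n (λ i → e (suc i))))

  evalUpTo-+ : ∀ c d n → evalUpTo (λ i → c i + d i) n ≈ evalUpTo c n + evalUpTo d n
  evalUpTo-+ c d zero    = sym (+-identityʳ _)
  evalUpTo-+ c d (suc n) = trans (+-congˡ (*-congˡ (evalUpTo-+ (c ∘ suc) (d ∘ suc) n)))
    (solve′ 5 (λ x y u v w → x :+′ y :+′ u :*′ (v :+′ w) :=′ x :+′ u :*′ v :+′ (y :+′ u :*′ w))
      refl (c 0) (d 0) u (evalUpTo (c ∘ suc) n) (evalUpTo (d ∘ suc) n))

  evalUpTo-0 : ∀ n → evalUpTo 0ₛ n ≈ 0#
  evalUpTo-0 zero    = refl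
  evalUpTo-0 (suc n) = trans (+-identityˡ _) (trans (*-congˡ (evalUpTo-0 n)) (zeroʳ u))

  indicator : Bool → Carrier
  indicator b = if b then 1# else 0#

  power : ℕ → Carrier
  power zero    = 1#
  power (suc r) = u * power r

  evalUpTo-indicator : ∀ r n → r ℕ.< n → evalUpTo (λ i → indicator (r ≡ᵇ i)) n ≈ power r
  evalUpTo-indicator zero    (suc n) _         =
    trans (+-congˡ (trans (*-congˡ (evalUpTo-0 n)) (zeroʳ u))) (+-identityʳ _)
  evalUpTo-indicator (suc r) (suc n) (s≤s r<n) =
    trans (+-identityˡ _) (*-congˡ (evalUpTo-indicator r n r<n))

  rightEdges<vertices : ∀ t → rightEdges t ℕ.< vertices t
  rightEdges<vertices leaf         = s≤s z≤n
  rightEdges<vertices (left t)     = ℕₚ.m≤n⇒m≤1+n (rightEdges<vertices t)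
  rightEdges<vertices (right t)    = s≤s (rightEdges<vertices t)
  rightEdges<vertices (both _ l r) = s≤s (ℕₚ.≤-trans
    (ℕₚ.+-monoʳ-≤ (suc (rightEdges l)) (ℕₚ.<⇒≤ (rightEdges<vertices r)))
    (ℕₚ.+-monoˡ-≤ (vertices r) (rightEdges<vertices l)))

  power-+ : ∀ r s → power (r ℕ.+ s) ≈ power r * power s
  power-+ zero    s = sym (*-identityˡ _)
  power-+ (suc r) s = trans (*-congˡ (power-+ r s)) (sym (*-assoc _ _ _))

  monomial-cong : ∀ {k k′} m → k ≈ k′ → monomial k m ≈ₛ monomial k′ m
  monomial-cong zero    e zero    = e
  monomial-cong zero    e (suc n) = refl
  monomial-cong (suc m) e zero    = refl
  monomial-cong (suc m) e (suc n) = monomial-cong m e n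

  monomial-product : ∀ k m k′ m′ {x y} → x ≈ₛ monomial k m → y ≈ₛ monomial k′ m′ →
                     x ⊛ y ≈ₛ monomial (k * k′) (m ℕ.+ m′)
  monomial-product k m k′ m′ e f = S.trans (⊛-cong e f) (monomial-⊛ k m k′ m′)

  weight≈monomial : ∀ t → weight t ≈ₛ monomial (power (rightEdges t)) (vertices t)
  weight≈monomial leaf         = S.refl {z}
  weight≈monomial (left t)     = S.trans
    (monomial-product 1# 1 (power (rightEdges t)) (vertices t) (S.refl {z}) (weight≈monomial t))
    (monomial-cong (suc (vertices t)) (*-identityˡ _))
  weight≈monomial (right t)    = S.trans
    (monomial-product 1# 1 (u * power (rightEdges t)) (vertices t) (S.refl {z})
      (monomial-product u 0 (power (rightEdges t)) (vertices t) (S.refl {U}) (weight≈monomial t)))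
    (monomial-cong (suc (vertices t)) (*-identityˡ _))
  weight≈monomial (both _ l r) = S.trans
    (monomial-product 1# 1 _ (vertices l ℕ.+ vertices r) (S.refl {z})
      (monomial-product u 0 _ (vertices l ℕ.+ vertices r) (S.refl {U})
        (monomial-product _ (vertices l) _ (vertices r) (weight≈monomial l) (weight≈monomial r))))
    (monomial-cong (suc (vertices l ℕ.+ vertices r))
      (trans (*-identityˡ _) (*-congˡ (sym (power-+ (rightEdges l) (rightEdges r))))))

  monomial-indicator : ∀ k m n → monomial k m n ≈ (if m ≡ᵇ n then k else 0#)
  monomial-indicator k zero    zero    = refl
  monomial-indicator k zero    (suc n) = refl
  monomial-indicator k (suc m) zero    = refl
  monomial-indicator k (suc m) (suc n) = monomial-indicator k m n

  -- A tree contributes nothing or a single power of `u`; `rightEdges<vertices` ensures that this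
  -- power is among the n terms that are summed.
  evalUpTo-shape : ∀ n t → evalUpTo (λ i → indicator (does (hasShape? n (suc i) t))) n ≈ weight t n
  evalUpTo-shape n t =
    trans (by-vertices (vertices t ≡ᵇ n) ≡.refl)
      (sym (trans (weight≈monomial t n) (monomial-indicator _ (vertices t) n)))
    where
    -- `does (hasShape? n (suc i) t)` computes to the conjunction of two Boolean tests. Generalising
    -- the first one allows a case split on it that is uniform in i.
    by-vertices : ∀ v → (vertices t ≡ᵇ n) ≡.≡ v →
      evalUpTo (λ i → indicator (v ∧ (rightEdges t ≡ᵇ i))) n ≈
      (if v then power (rightEdges t) else 0#)
    by-vertices false _ = evalUpTo-0 n
    by-vertices true  e = evalUpTo-indicator (rightEdges t) n (≡.subst (rightEdges t ℕ.<_)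
      (ℕₚ.≡ᵇ⇒≡ (vertices t) n (≡.subst IsTrue (≡.sym e) _)) (rightEdges<vertices t))

  -- Induction on the list interchanges the sum over k with the sum over trees.
  evalUpTo-filter : ∀ n ts →
    evalUpTo (λ i → length (filter (hasShape? n (suc i)) ts) ℕ× 1#) n ≈ total ts n
  evalUpTo-filter n []       = evalUpTo-0 n
  evalUpTo-filter n (t ∷ ts) = begin
    evalUpTo (λ i → length (filter (hasShape? n (suc i)) (t ∷ ts)) ℕ× 1#) n
      ≈⟨ evalUpTo-cong n split ⟩
    evalUpTo (λ i → indicator (does (hasShape? n (suc i) t)) +
                    length (filter (hasShape? n (suc i)) ts) ℕ× 1#) n
      ≈⟨ evalUpTo-+ _ _ n ⟩
    evalUpTo (λ i → indicator (does (hasShape? n (suc i) t))) n +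
    evalUpTo (λ i → length (filter (hasShape? n (suc i)) ts) ℕ× 1#) n
      ≈⟨ +-cong (evalUpTo-shape n t) (evalUpTo-filter n ts) ⟩
    total (t ∷ ts) n ∎
    where
    split : ∀ i → length (filter (hasShape? n (suc i)) (t ∷ ts)) ℕ× 1# ≈
      indicator (does (hasShape? n (suc i) t)) + length (filter (hasShape? n (suc i)) ts) ℕ× 1#
    split i with does (hasShape? n (suc i) t)
    ... | true  = refl
    ... | false = sym (+-identityˡ _)

  evalUpTo-BoNa : ∀ n → evalUpTo (λ i → BoNa n (suc i) ℕ× 1#) n ≈ b n
  evalUpTo-BoNa n = evalUpTo-filter n (treesOfHeight≤ n)

-- Rational numbers and sequences

open ℚ using (ℚ; mkℚ; 0ℚ; 1ℚ; ½; _/_; _+_; _*_; -_; _-_; ∣_∣; _<_; 1/_; _⊓_; positive; nonNegative; toℚᵘ)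
  renaming (_≤_ to _≤ℚ_)
open ≡ using (_≡_; refl; sym; trans; cong; cong₂; subst; subst₂)
open ℚSolver.+-*-Solver
open ℚₚ.≤-Reasoning
open Mult (CommutativeRing.semiring ℚₚ.+-*-commutativeRing) using () renaming (_×_ to _ℕ×_)

0<1 : 0ℚ < 1ℚ
0<1 = ℚₚ.positive⁻¹ 1ℚ

0<½ : 0ℚ < ½
0<½ = ℚₚ.positive⁻¹ ½

+-pos : ∀ {p q} → 0ℚ < p → 0ℚ < q → 0ℚ < p + q
+-pos = ℚₚ.+-mono-<

*-pos : ∀ {p q} → 0ℚ < p → 0ℚ < q → 0ℚ < p * q
*-pos {p} {q} 0<p 0<q = ℚₚ.positive⁻¹ _ {{ℚₚ.pos*pos⇒pos p {{positive 0<p}} q {{positive 0<q}}}}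

*-nonNeg : ∀ {p q} → 0ℚ ≤ℚ p → 0ℚ ≤ℚ q → 0ℚ ≤ℚ p * q
*-nonNeg {p} {q} 0≤p 0≤q =
  ℚₚ.nonNegative⁻¹ _ {{ℚₚ.nonNeg*nonNeg⇒nonNeg p {{nonNegative 0≤p}} q {{nonNegative 0≤q}}}}

*-monoˡ : ∀ r {p q} → 0ℚ ≤ℚ r → p ≤ℚ q → r * p ≤ℚ r * q
*-monoˡ r 0≤r = ℚₚ.*-monoˡ-≤-nonNeg r {{nonNegative 0≤r}}

*-mono : ∀ {p q r s} → 0ℚ ≤ℚ p → 0ℚ ≤ℚ s → p ≤ℚ q → r ≤ℚ s → p * r ≤ℚ q * s
*-mono {p} {q} {r} {s} 0≤p 0≤s p≤q r≤s =
  ℚₚ.≤-trans (*-monoˡ p 0≤p r≤s) (ℚₚ.*-monoʳ-≤-nonNeg s {{nonNegative 0≤s}} p≤q)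

*-monoˡ-< : ∀ r {p q} → 0ℚ < r → p < q → r * p < r * q
*-monoˡ-< r 0<r = ℚₚ.*-monoʳ-<-pos r {{positive 0<r}}

0<q-p : ∀ {p q} → p < q → 0ℚ < q - p
0<q-p {p} {q} p<q = subst (_< q - p) (ℚₚ.+-inverseʳ p) (ℚₚ.+-monoˡ-< (- p) p<q)

0≤q-p : ∀ {p q} → p ≤ℚ q → 0ℚ ≤ℚ q - p
0≤q-p {p} {q} p≤q = subst (_≤ℚ q - p) (ℚₚ.+-inverseʳ p) (ℚₚ.+-monoˡ-≤ (- p) p≤q)

diff : ∀ p q → q - p + p ≡ q
diff = solve 2 (λ p q → q :- p :+ p := q) refl

0<q-p⇒p<q : ∀ {p q} → 0ℚ < q - p → p < q
0<q-p⇒p<q {p} {q} h =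
  ≡.subst₂ _<_ (ℚₚ.+-identityˡ p) (diff p q) (ℚₚ.+-monoˡ-< p h)

0≤q-p⇒p≤q : ∀ {p q} → 0ℚ ≤ℚ q - p → p ≤ℚ q
0≤q-p⇒p≤q {p} {q} h =
  ≡.subst₂ _≤ℚ_ (ℚₚ.+-identityˡ p) (diff p q) (ℚₚ.+-monoˡ-≤ p h)

half>0 : ∀ {ε} → 0ℚ < ε → 0ℚ < ε * ½
half>0 0<ε = *-pos 0<ε 0<½

halves : ∀ ε → ε * ½ + ε * ½ ≡ ε
halves ε = trans (sym (ℚₚ.*-distribˡ-+ ε ½ ½)) (ℚₚ.*-identityʳ ε)

∣-∣-≤ : ∀ {p w} → p ≤ℚ w → - p ≤ℚ w → ∣ p ∣ ≤ℚ w
∣-∣-≤ {p} p≤w -p≤w with ℚₚ.∣p∣≡p∨∣p∣≡-p p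
... | inj₁ e = subst (_≤ℚ _) (sym e) p≤w
... | inj₂ e = subst (_≤ℚ _) (sym e) -p≤w

p≤∣p∣ : ∀ p → p ≤ℚ ∣ p ∣
p≤∣p∣ p with ℚₚ.≤-total 0ℚ p
... | inj₁ 0≤p = ℚₚ.≤-reflexive (sym (ℚₚ.0≤p⇒∣p∣≡p 0≤p))
... | inj₂ p≤0 = ℚₚ.≤-trans p≤0 (ℚₚ.0≤∣p∣ p)

-p≤∣p∣ : ∀ p → - p ≤ℚ ∣ p ∣
-p≤∣p∣ p = subst (- p ≤ℚ_) (ℚₚ.∣-p∣≡∣p∣ p) (p≤∣p∣ (- p))

reciprocal : ∀ p → 0ℚ < p → ∃[ r ] 0ℚ < r × p * r ≡ 1ℚ
reciprocal p 0<p =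
  (1/ p) {{nz}} , ℚₚ.positive⁻¹ _ {{ℚₚ.1/pos⇒pos p {{positive 0<p}}}} , ℚₚ.*-inverseʳ p {{nz}}
  where nz = ℚₚ.pos⇒nonZero p {{positive 0<p}}

-- Links `fromℕ` to the multiples of 1 in the semiring development. As `_/_` normalises fractions,
-- the comparison is made among unnormalised rationals.
n/1≡n×1 : ∀ n → ℤ.+ n / 1 ≡ n ℕ× 1ℚ
n/1≡n×1 zero    = refl
n/1≡n×1 (suc n) = trans (ℚₚ.toℚᵘ-injective eq) (cong (λ q → 1ℚ + q) (n/1≡n×1 n))
  where
  of : ℕ → ℚᵘ.ℚᵘ
  of n = ℚᵘ.mkℚᵘ (ℤ.+ n) 0
  eq : toℚᵘ (ℤ.+ suc n / 1) ℚᵘ.≃ toℚᵘ (1ℚ + (ℤ.+ n / 1))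
  eq = ℚᵘₚ.≃-trans (ℚₚ.toℚᵘ-fromℚᵘ (of (suc n))) (ℚᵘₚ.≃-sym (ℚᵘₚ.≃-trans
    (ℚₚ.toℚᵘ-homo-+ 1ℚ (ℤ.+ n / 1)) (ℚᵘₚ.≃-trans
      (ℚᵘₚ.+-congʳ (of 1) (ℚₚ.toℚᵘ-fromℚᵘ (of n)))
      (ℚᵘ.*≡* (cong (λ i → (ℤ.+ 1 ℤ.+ i) ℤ.* ℤ.+ 1) (ℤₚ.*-identityʳ (ℤ.+ n)))))))

archimedean : ∀ q → ∃[ n ] q < n ℕ× 1ℚ
archimedean q@(mkℚ i d _) = suc ℤ.∣ i ∣ , subst (q <_) (n/1≡n×1 (suc ℤ.∣ i ∣))
  (ℚₚ.toℚᵘ-cancel-< (ℚᵘₚ.<-respʳ-≃ (ℚᵘₚ.≃-sym (ℚₚ.toℚᵘ-fromℚᵘ (ℚᵘ.mkℚᵘ (ℤ.+ suc ℤ.∣ i ∣) 0)))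
    (ℚᵘ.*<* (ℤₚ.≤-<-trans (i≤∣i∣ (i ℤ.* ℤ.+ 1)) (ℤ.+<+ bound)))))
  where
  i≤∣i∣ : ∀ i → i ℤ.≤ ℤ.+ ℤ.∣ i ∣
  i≤∣i∣ (ℤ.+ n)       = ℤₚ.≤-refl
  i≤∣i∣ ℤ.-[1+ n ] = ℤ.-≤+
  bound : ℤ.∣ i ℤ.* ℤ.+ 1 ∣ ℕ.< suc ℤ.∣ i ∣ ℕ.* suc d
  bound = ℕₚ.≤-trans (ℕ.s≤s (ℕₚ.≤-reflexive (cong ℤ.∣_∣ (ℤₚ.*-identityʳ i)))) (ℕₚ.m≤m*n (suc ℤ.∣ i ∣) (suc d))

Eventually : (ℕ → Set) → Set
Eventually P = ∃[ N ] (∀ n → N ℕ.≤ n → P n)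

Eventually-map : ∀ {P Q : ℕ → Set} → (∀ n → P n → Q n) → Eventually P → Eventually Q
Eventually-map f (N , h) = N , λ n N≤n → f n (h n N≤n)

Eventually-zip : ∀ {P Q R : ℕ → Set} → (∀ n → P n → Q n → R n) →
                 Eventually P → Eventually Q → Eventually R
Eventually-zip f (M , g) (N , h) = M ⊔ N , λ n ≤n →
  f n (g n (ℕₚ.m⊔n≤o⇒m≤o M N ≤n)) (h n (ℕₚ.m⊔n≤o⇒n≤o M N ≤n))

-- Being equal to 0 and being positive as a real, stated for bare sequences so that the algebra
-- carries no Cauchy proofs.
Null Pos : (ℕ → ℚ) → Set
Null s = ∀ ε → 0ℚ < ε → Eventually (λ n → ∣ s n ∣ < ε)
Pos s = ∃[ ε ] 0ℚ < ε × Eventually (λ n → ε < s n)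

½^ : ℕ → ℚ
½^ zero    = 1ℚ
½^ (suc k) = ½^ k * ½

0<½^ : ∀ k → 0ℚ < ½^ k
0<½^ zero    = 0<1
0<½^ (suc k) = half>0 (0<½^ k)

half≤ : ∀ {p} → 0ℚ ≤ℚ p → p * ½ ≤ℚ p
half≤ {p} 0≤p = begin
  p * ½           ≡⟨ ℚₚ.+-identityʳ _ ⟨
  p * ½ + 0ℚ      ≤⟨ ℚₚ.+-monoʳ-≤ (p * ½) (*-nonNeg 0≤p (ℚₚ.<⇒≤ 0<½)) ⟩
  p * ½ + p * ½   ≡⟨ halves p ⟩
  p               ∎

½^-antitone : ∀ N j → ½^ (j ℕ.+ N) ≤ℚ ½^ N
½^-antitone N zero    = ℚₚ.≤-refl
½^-antitone N (suc j) = ℚₚ.≤-trans (half≤ (ℚₚ.<⇒≤ (0<½^ (j ℕ.+ N)))) (½^-antitone N j)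

n½^n≤1 : ∀ n → n ℕ× 1ℚ * ½^ n ≤ℚ 1ℚ
n½^n≤1 zero    = ℚₚ.<⇒≤ 0<1
n½^n≤1 (suc n) = begin
  (1ℚ + n ℕ× 1ℚ) * (½^ n * ½)
    ≡⟨ solve 3 (λ x h k → (con 1ℚ :+ x) :* (h :* k) := h :* k :+ x :* h :* k) refl (n ℕ× 1ℚ) (½^ n) ½ ⟩
  ½^ n * ½ + n ℕ× 1ℚ * ½^ n * ½
    ≤⟨ ℚₚ.+-mono-≤ (ℚₚ.*-monoʳ-≤-nonNeg ½ (subst (λ k → ½^ k ≤ℚ 1ℚ) (ℕₚ.+-identityʳ n) (½^-antitone 0 n)))
                   (ℚₚ.*-monoʳ-≤-nonNeg ½ (n½^n≤1 n)) ⟩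
  1ℚ * ½ + 1ℚ * ½
    ≡⟨ halves 1ℚ ⟩
  1ℚ ∎

-- For a natural number N above C / ε one has C 2^(-N) < ε N 2^(-N), and N 2^(-N) is at most 1.
½^-null : ∀ C ε → 0ℚ ≤ℚ C → 0ℚ < ε → Eventually (λ k → C * ½^ k < ε)
½^-null C ε 0≤C 0<ε with reciprocal ε 0<ε
... | r , 0<r , εr with archimedean (C * r)
... | N , Cr<N = N , λ k N≤k → begin-strict
  C * ½^ k                     ≤⟨ *-monoˡ C 0≤C (subst (λ k → ½^ k ≤ℚ ½^ N) (ℕₚ.m∸n+n≡m N≤k) (½^-antitone N (k ℕ.∸ N))) ⟩
  C * ½^ N                     ≡⟨ ℚₚ.*-identityˡ _ ⟨
  1ℚ * (C * ½^ N)              ≡⟨ cong (_* (C * ½^ N)) εr ⟨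
  ε * r * (C * ½^ N)           ≡⟨ solve 4 (λ e r c h → e :* r :* (c :* h) := (e :* h) :* (c :* r)) refl ε r C (½^ N) ⟩
  ε * ½^ N * (C * r)           <⟨ *-monoˡ-< (ε * ½^ N) (*-pos 0<ε (0<½^ N)) Cr<N ⟩
  ε * ½^ N * (N ℕ× 1ℚ)         ≡⟨ solve 3 (λ e h n → e :* h :* n := e :* (n :* h)) refl ε (½^ N) (N ℕ× 1ℚ) ⟩
  ε * (N ℕ× 1ℚ * ½^ N)         ≤⟨ *-monoˡ ε (ℚₚ.<⇒≤ 0<ε) (n½^n≤1 N) ⟩
  ε * 1ℚ                       ≡⟨ ℚₚ.*-identityʳ ε ⟩
  ε                            ∎

-- An effective form of continuity: the constant turns a width into a bound on values, both in the
-- bisection and in `ball`. Products need bounded factors, hence the restriction to bounded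
-- arguments.
LocallyLipschitz : (ℚ → ℚ) → Set
LocallyLipschitz F = ∀ B → 0ℚ ≤ℚ B → ∃[ L ] 0ℚ < L ×
  (∀ x y → ∣ x ∣ ≤ℚ B → ∣ y ∣ ≤ℚ B → ∣ F x - F y ∣ ≤ℚ L * ∣ x - y ∣)

lipschitz-const : ∀ c → LocallyLipschitz (λ _ → c)
lipschitz-const c B _ = 1ℚ , 0<1 , λ x y _ _ →
  subst (_≤ℚ 1ℚ * ∣ x - y ∣) (cong ∣_∣ (sym (ℚₚ.+-inverseʳ c)))
    (*-nonNeg (ℚₚ.<⇒≤ 0<1) (ℚₚ.0≤∣p∣ (x - y)))

lipschitz-id : LocallyLipschitz (λ x → x)
lipschitz-id B _ = 1ℚ , 0<1 , λ x y _ _ → ℚₚ.≤-reflexive (sym (ℚₚ.*-identityˡ _))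

lipschitz-+ : ∀ {F G} → LocallyLipschitz F → LocallyLipschitz G → LocallyLipschitz (λ x → F x + G x)
lipschitz-+ {F} {G} f g B 0≤B with f B 0≤B | g B 0≤B
... | L , 0<L , fL | M , 0<M , gM = L + M , +-pos 0<L 0<M , λ x y x≤ y≤ → begin
  ∣ F x + G x - (F y + G y) ∣
    ≡⟨ cong ∣_∣ (solve 4 (λ a b c d → a :+ b :- (c :+ d) := (a :- c) :+ (b :- d)) refl (F x) (G x) (F y) (G y)) ⟩
  ∣ (F x - F y) + (G x - G y) ∣     ≤⟨ ℚₚ.∣p+q∣≤∣p∣+∣q∣ (F x - F y) (G x - G y) ⟩
  ∣ F x - F y ∣ + ∣ G x - G y ∣     ≤⟨ ℚₚ.+-mono-≤ (fL x y x≤ y≤) (gM x y x≤ y≤) ⟩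
  L * ∣ x - y ∣ + M * ∣ x - y ∣     ≡⟨ ℚₚ.*-distribʳ-+ ∣ x - y ∣ L M ⟨
  (L + M) * ∣ x - y ∣               ∎

lipschitz-bounded : ∀ {F} → LocallyLipschitz F → ∀ B → 0ℚ ≤ℚ B →
                    ∃[ C ] 0ℚ < C × (∀ x → ∣ x ∣ ≤ℚ B → ∣ F x ∣ ≤ℚ C)
lipschitz-bounded {F} f B 0≤B with f B 0≤B
... | L , 0<L , fL = L * B + (1ℚ + ∣ F 0ℚ ∣) ,
  ℚₚ.+-mono-≤-< (*-nonNeg (ℚₚ.<⇒≤ 0<L) 0≤B) (ℚₚ.+-mono-<-≤ 0<1 (ℚₚ.0≤∣p∣ (F 0ℚ))) , λ x x≤ → begin
  ∣ F x ∣                         ≡⟨ cong ∣_∣ (diff (F 0ℚ) (F x)) ⟨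
  ∣ F x - F 0ℚ + F 0ℚ ∣           ≤⟨ ℚₚ.∣p+q∣≤∣p∣+∣q∣ (F x - F 0ℚ) (F 0ℚ) ⟩
  ∣ F x - F 0ℚ ∣ + ∣ F 0ℚ ∣       ≤⟨ ℚₚ.+-monoˡ-≤ ∣ F 0ℚ ∣ (fL x 0ℚ x≤ 0≤B) ⟩
  L * ∣ x - 0ℚ ∣ + ∣ F 0ℚ ∣       ≡⟨ cong (λ y → L * ∣ y ∣ + ∣ F 0ℚ ∣) (ℚₚ.+-identityʳ x) ⟩
  L * ∣ x ∣ + ∣ F 0ℚ ∣            ≤⟨ ℚₚ.+-mono-≤ (*-monoˡ L (ℚₚ.<⇒≤ 0<L) x≤) ∣F0∣≤ ⟩
  L * B + (1ℚ + ∣ F 0ℚ ∣)         ∎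
  where
  ∣F0∣≤ : ∣ F 0ℚ ∣ ≤ℚ 1ℚ + ∣ F 0ℚ ∣
  ∣F0∣≤ = subst (_≤ℚ 1ℚ + ∣ F 0ℚ ∣) (ℚₚ.+-identityˡ _) (ℚₚ.+-monoˡ-≤ ∣ F 0ℚ ∣ (ℚₚ.<⇒≤ 0<1))

product-diff : ∀ a b c d → a * b - c * d ≡ a * (b - d) + d * (a - c)
product-diff = solve 4 (λ a b c d → a :* b :- c :* d := a :* (b :- d) :+ d :* (a :- c)) refl

common-factor : ∀ c m d l w → c * (m * w) + d * (l * w) ≡ (c * m + d * l) * w
common-factor = solve 5 (λ c m d l w → c :* (m :* w) :+ d :* (l :* w) := (c :* m :+ d :* l) :* w) refl

∣*∣-mono : ∀ p q {c d} → ∣ p ∣ ≤ℚ c → ∣ q ∣ ≤ℚ d → ∣ p * q ∣ ≤ℚ c * d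
∣*∣-mono p q {c} {d} p≤c q≤d = subst (_≤ℚ c * d) (sym (ℚₚ.∣p*q∣≡∣p∣*∣q∣ p q))
  (*-mono (ℚₚ.0≤∣p∣ p) (ℚₚ.≤-trans (ℚₚ.0≤∣p∣ q) q≤d) p≤c q≤d)

lipschitz-* : ∀ {F G} → LocallyLipschitz F → LocallyLipschitz G → LocallyLipschitz (λ x → F x * G x)
lipschitz-* {F} {G} f g B 0≤B =
  let L , 0<L , fL = f B 0≤B
      M , 0<M , gM = g B 0≤B
      C , 0<C , fC = lipschitz-bounded f B 0≤B
      D , 0<D , gD = lipschitz-bounded g B 0≤B
  in C * M + D * L , +-pos (*-pos 0<C 0<M) (*-pos 0<D 0<L) , λ x y x≤ y≤ → begin
  ∣ F x * G x - F y * G y ∣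
    ≡⟨ cong ∣_∣ (product-diff (F x) (G x) (F y) (G y)) ⟩
  ∣ F x * (G x - G y) + G y * (F x - F y) ∣
    ≤⟨ ℚₚ.∣p+q∣≤∣p∣+∣q∣ (F x * (G x - G y)) (G y * (F x - F y)) ⟩
  ∣ F x * (G x - G y) ∣ + ∣ G y * (F x - F y) ∣
    ≤⟨ ℚₚ.+-mono-≤ (∣*∣-mono (F x) (G x - G y) (fC x x≤) (gM x y x≤ y≤))
                   (∣*∣-mono (G y) (F x - F y) (gD y y≤) (fL x y x≤ y≤)) ⟩
  C * (M * ∣ x - y ∣) + D * (L * ∣ x - y ∣)
    ≡⟨ common-factor C M D L ∣ x - y ∣ ⟩
  (C * M + D * L) * ∣ x - y ∣ ∎

-- Bisection between rational endpoints

within : ∀ x y c w → c ≤ℚ x × x ≤ℚ c + w → c ≤ℚ y × y ≤ℚ c + w → ∣ x - y ∣ ≤ℚ w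
within x y c w (c≤x , x≤) (c≤y , y≤) = ∣-∣-≤ (difference x y x≤ c≤y)
  (subst (_≤ℚ w) (negate x y) (difference y x y≤ c≤x))
  where
  cancel : ∀ c w → c + w - c ≡ w
  cancel = solve 2 (λ c w → c :+ w :- c := w) refl
  negate : ∀ x y → y - x ≡ - (x - y)
  negate = solve 2 (λ x y → y :- x := :- (x :- y)) refl
  difference : ∀ x y → x ≤ℚ c + w → c ≤ℚ y → x - y ≤ℚ w
  difference x y x≤ c≤y =
    subst (x - y ≤ℚ_) (cancel c w) (ℚₚ.+-mono-≤ x≤ (ℚₚ.neg-antimono-≤ c≤y))

-- The invariant is asymmetric, positive on the left and at most 0 on the right, so that the one
-- decision `0ℚ <? G m` settles every step, even if the midpoint is a root.
module Bisection (G : ℚ → ℚ) (lip : LocallyLipschitz G) (a b : ℚ) (a<b : a < b)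
                 (0<Ga : 0ℚ < G a) (Gb≤0 : G b ≤ℚ 0ℚ) where

  width lower : ℕ → ℚ
  width k = (b - a) * ½^ k

  0<width : ∀ k → 0ℚ < width k
  0<width k = *-pos (0<q-p a<b) (0<½^ k)

  choose : ℚ → ℚ → ℚ
  choose l m with 0ℚ ℚₚ.<? G m
  ... | yes _ = m
  ... | no  _ = l

  lower zero    = a
  lower (suc k) = choose (lower k) (lower k + width (suc k))

  record Halved (l w l′ w′ : ℚ) : Set where
    field
      positiveˡ : 0ℚ < G l′
      nonPosʳ   : G (l′ + w′) ≤ℚ 0ℚ
      l≤l′      : l ≤ℚ l′
      r′≤r      : l′ + w′ ≤ℚ l + w
  open Halved

  choose-halved : ∀ l h → 0ℚ < h → 0ℚ < G l → G (l + (h + h)) ≤ℚ 0ℚ →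
                  Halved l (h + h) (choose l (l + h)) h
  choose-halved l h 0<h 0<Gl Gr≤0 with 0ℚ ℚₚ.<? G (l + h)
  ... | yes 0<Gm = record
    { positiveˡ = 0<Gm
    ; nonPosʳ   = subst (λ x → G x ≤ℚ 0ℚ) (sym (ℚₚ.+-assoc l h h)) Gr≤0
    ; l≤l′      = subst (_≤ℚ l + h) (ℚₚ.+-identityʳ l) (ℚₚ.+-monoʳ-≤ l (ℚₚ.<⇒≤ 0<h))
    ; r′≤r      = ℚₚ.≤-reflexive (ℚₚ.+-assoc l h h) }
  ... | no ¬0<Gm = record
    { positiveˡ = 0<Gl
    ; nonPosʳ   = ℚₚ.≮⇒≥ ¬0<Gm
    ; l≤l′      = ℚₚ.≤-refl
    ; r′≤r      = ℚₚ.+-monoʳ-≤ l (subst (_≤ℚ h + h) (ℚₚ.+-identityʳ h) (ℚₚ.+-monoʳ-≤ h (ℚₚ.<⇒≤ 0<h))) }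

  width-halves : ∀ k → width (suc k) + width (suc k) ≡ width k
  width-halves k = trans
    (cong (λ w → w + w) (sym (ℚₚ.*-assoc (b - a) (½^ k) ½))) (halves (width k))

  mutual
    0<Gl : ∀ k → 0ℚ < G (lower k)
    0<Gl zero    = 0<Ga
    0<Gl (suc k) = positiveˡ (halved k)

    Gr≤0 : ∀ k → G (lower k + width k) ≤ℚ 0ℚ
    Gr≤0 zero    = subst (λ x → G x ≤ℚ 0ℚ)
      (solve 2 (λ a b → b := a :+ (b :- a) :* con 1ℚ) refl a b) Gb≤0
    Gr≤0 (suc k) = nonPosʳ (halved k)

    halved : ∀ k → Halved (lower k) (width k) (lower (suc k)) (width (suc k))
    halved k = subst (λ w → Halved (lower k) w (lower (suc k)) (width (suc k))) (width-halves k)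
      (choose-halved (lower k) (width (suc k)) (0<width (suc k)) (0<Gl k)
        (subst (λ w → G (lower k + w) ≤ℚ 0ℚ) (sym (width-halves k)) (Gr≤0 k)))

  lower-mono : ∀ j k → lower k ≤ℚ lower (j ℕ.+ k)
  lower-mono zero    k = ℚₚ.≤-refl
  lower-mono (suc j) k = ℚₚ.≤-trans (lower-mono j k) (l≤l′ (halved (j ℕ.+ k)))

  upper-mono : ∀ j k → lower (j ℕ.+ k) + width (j ℕ.+ k) ≤ℚ lower k + width k
  upper-mono zero    k = ℚₚ.≤-refl
  upper-mono (suc j) k = ℚₚ.≤-trans (r′≤r (halved (j ℕ.+ k))) (upper-mono j k)

  lower≤upper : ∀ k → lower k ≤ℚ lower k + width k
  lower≤upper k = subst (_≤ℚ lower k + width k) (ℚₚ.+-identityʳ _)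
    (ℚₚ.+-monoʳ-≤ (lower k) (ℚₚ.<⇒≤ (0<width k)))

  nested : ∀ {N k} → N ℕ.≤ k → lower N ≤ℚ lower k × lower k ≤ℚ lower N + width N
  nested {N} {k} N≤k = subst (λ k → lower N ≤ℚ lower k × lower k ≤ℚ lower N + width N) (ℕₚ.m∸n+n≡m N≤k)
    (lower-mono (k ℕ.∸ N) N , ℚₚ.≤-trans (lower≤upper (k ℕ.∸ N ℕ.+ N)) (upper-mono (k ℕ.∸ N) N))

  width-null : ∀ ε → 0ℚ < ε → Eventually (λ k → width k < ε)
  width-null ε 0<ε = ½^-null (b - a) ε (ℚₚ.<⇒≤ (0<q-p a<b)) 0<ε

  lower-within : ∀ N m n → N ℕ.≤ m → N ℕ.≤ n → ∣ lower m - lower n ∣ ≤ℚ width N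
  lower-within N m n N≤m N≤n =
    within (lower m) (lower n) (lower N) (width N) (nested {N} {m} N≤m) (nested {N} {n} N≤n)

  lower-cauchy : IsCauchy lower
  lower-cauchy ε 0<ε =
    let N , small = width-null ε 0<ε in
    N , λ m n N≤m N≤n → ℚₚ.≤-<-trans (lower-within N m n N≤m N≤n) (small N ℕₚ.≤-refl)

  root : ℝ
  root = mkℝ lower lower-cauchy

  a≤root : ∀ k → a ≤ℚ lower k
  a≤root k = proj₁ (nested {0} {k} ℕ.z≤n)

  upper≤b : ∀ k → lower k + width k ≤ℚ b
  upper≤b k = ℚₚ.≤-trans
    (subst (λ k → lower k + width k ≤ℚ lower 0 + width 0) (ℕₚ.+-identityʳ k) (upper-mono k 0))
    (ℚₚ.≤-reflexive (solve 2 (λ a b → a :+ (b :- a) :* con 1ℚ := b) refl a b))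

  root≤b : ∀ k → lower k ≤ℚ b
  root≤b k = ℚₚ.≤-trans (lower≤upper k) (upper≤b k)

  -- With l and r the ends of an interval, 0 < G l and G r ≤ 0 give |G l| ≤ G l - G r, which the
  -- Lipschitz constant bounds by a multiple of the width.
  root-null : Null (G ∘ lower)
  root-null ε 0<ε with lip (∣ a ∣ + ∣ b ∣) (ℚₚ.+-mono-≤ (ℚₚ.0≤∣p∣ a) (ℚₚ.0≤∣p∣ b))
  ... | L , 0<L , GL = Eventually-map (λ k Lw<ε → ℚₚ.≤-<-trans (bound k) Lw<ε)
      (½^-null (L * (b - a)) ε (ℚₚ.<⇒≤ (*-pos 0<L (0<q-p a<b))) 0<ε)
    where
    bounded : ∀ {x} → a ≤ℚ x → x ≤ℚ b → ∣ x ∣ ≤ℚ ∣ a ∣ + ∣ b ∣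
    bounded {x} a≤x x≤b = ∣-∣-≤
      (begin x             ≤⟨ x≤b ⟩
             b             ≤⟨ p≤∣p∣ b ⟩
             ∣ b ∣         ≡⟨ ℚₚ.+-identityˡ _ ⟨
             0ℚ + ∣ b ∣    ≤⟨ ℚₚ.+-monoˡ-≤ ∣ b ∣ (ℚₚ.0≤∣p∣ a) ⟩
             ∣ a ∣ + ∣ b ∣ ∎)
      (begin - x           ≤⟨ ℚₚ.neg-antimono-≤ a≤x ⟩
             - a           ≤⟨ -p≤∣p∣ a ⟩
             ∣ a ∣         ≡⟨ ℚₚ.+-identityʳ _ ⟨
             ∣ a ∣ + 0ℚ    ≤⟨ ℚₚ.+-monoʳ-≤ ∣ a ∣ (ℚₚ.0≤∣p∣ b) ⟩
             ∣ a ∣ + ∣ b ∣ ∎)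
    bound : ∀ k → ∣ G (lower k) ∣ ≤ℚ L * (b - a) * ½^ k
    bound k = begin
      ∣ G l ∣              ≡⟨ ℚₚ.0≤p⇒∣p∣≡p (ℚₚ.<⇒≤ (0<Gl k)) ⟩
      G l                  ≡⟨ ℚₚ.+-identityʳ _ ⟨
      G l + 0ℚ             ≤⟨ ℚₚ.+-monoʳ-≤ (G l) (ℚₚ.neg-antimono-≤ (Gr≤0 k)) ⟩
      G l - G r            ≤⟨ p≤∣p∣ (G l - G r) ⟩
      ∣ G l - G r ∣        ≤⟨ GL l r (bounded (a≤root k) (root≤b k))
                                     (bounded (ℚₚ.≤-trans (a≤root k) (lower≤upper k)) (upper≤b k)) ⟩
      L * ∣ l - r ∣        ≡⟨ cong (λ x → L * ∣ x ∣) (solve 2 (λ l w → l :- (l :+ w) := :- w) refl l (width k)) ⟩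
      L * ∣ - width k ∣    ≡⟨ cong (L *_) (trans (ℚₚ.∣-p∣≡∣p∣ (width k)) (ℚₚ.0≤p⇒∣p∣≡p (ℚₚ.<⇒≤ (0<width k)))) ⟩
      L * width k          ≡⟨ ℚₚ.*-assoc L (b - a) (½^ k) ⟨
      L * (b - a) * ½^ k   ∎
      where
      l = lower k
      r = lower k + width k

-- The intermediate value theorem for real endpoints

⊓-pos : ∀ {p q} → 0ℚ < p → 0ℚ < q → 0ℚ < p ⊓ q
⊓-pos {p} {q} 0<p 0<q with ℚₚ.⊓-sel p q
... | inj₁ e = subst (0ℚ <_) (sym e) 0<p
... | inj₂ e = subst (0ℚ <_) (sym e) 0<q

-- Calculus of null sequences and of sequences bounded below by a positive constant

null-cong : ∀ {s t} → (∀ n → s n ≡ t n) → Null s → Null t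
null-cong e h ε 0<ε = Eventually-map (λ n → subst (_< ε) (cong ∣_∣ (e n))) (h ε 0<ε)

pos-cong : ∀ {s t} → (∀ n → s n ≡ t n) → Pos s → Pos t
pos-cong e (ε , 0<ε , h) = ε , 0<ε , Eventually-map (λ n → subst (ε <_) (e n)) h

null-0 : Null (λ _ → 0ℚ)
null-0 ε 0<ε = 0 , λ _ _ → 0<ε

null-+ : ∀ {s t} → Null s → Null t → Null (λ n → s n + t n)
null-+ {s} {t} f g ε 0<ε = Eventually-zip
  (λ n s< t< → ℚₚ.≤-<-trans (ℚₚ.∣p+q∣≤∣p∣+∣q∣ (s n) (t n))
    (subst (∣ s n ∣ + ∣ t n ∣ <_) (halves ε) (ℚₚ.+-mono-< s< t<)))
  (f (ε * ½) (half>0 0<ε)) (g (ε * ½) (half>0 0<ε))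

null-neg : ∀ {s} → Null s → Null (λ n → - s n)
null-neg {s} f ε 0<ε = Eventually-map (λ n → subst (_< ε) (sym (ℚₚ.∣-p∣≡∣p∣ (s n)))) (f ε 0<ε)

cauchy-bounded : ∀ (x : ℝ) → ∃[ B ] 0ℚ < B × Eventually (λ n → ∣ seq x n ∣ ≤ℚ B)
cauchy-bounded x with cauchy x 1ℚ 0<1
... | N , h = 1ℚ + ∣ seq x N ∣ , ℚₚ.+-mono-<-≤ 0<1 (ℚₚ.0≤∣p∣ (seq x N)) , N , λ n N≤n → begin
  ∣ seq x n ∣                         ≡⟨ cong ∣_∣ (diff (seq x N) (seq x n)) ⟨
  ∣ seq x n - seq x N + seq x N ∣     ≤⟨ ℚₚ.∣p+q∣≤∣p∣+∣q∣ (seq x n - seq x N) (seq x N) ⟩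
  ∣ seq x n - seq x N ∣ + ∣ seq x N ∣ ≤⟨ ℚₚ.+-monoˡ-≤ ∣ seq x N ∣ (ℚₚ.<⇒≤ (h n N N≤n ℕₚ.≤-refl)) ⟩
  1ℚ + ∣ seq x N ∣                    ∎

cancel-reciprocal : ∀ B r ε → B * r ≡ 1ℚ → B * (ε * r) ≡ ε
cancel-reciprocal B r ε e = trans
  (solve 3 (λ B r ε → B :* (ε :* r) := ε :* (B :* r)) refl B r ε)
  (trans (cong (ε *_) e) (ℚₚ.*-identityʳ ε))

-- The factor is a real number rather than any sequence because its Cauchy property supplies the
-- bound.
null-*ˡ : ∀ (x : ℝ) {s} → Null s → Null (λ n → seq x n * s n)
null-*ˡ x {s} f ε 0<ε =
  let B , 0<B , bounded = cauchy-bounded x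
      r , 0<r , Br≡1    = reciprocal B 0<B
  in Eventually-zip (λ n x≤ s< → begin-strict
       ∣ seq x n * s n ∣     ≡⟨ ℚₚ.∣p*q∣≡∣p∣*∣q∣ (seq x n) (s n) ⟩
       ∣ seq x n ∣ * ∣ s n ∣ ≤⟨ ℚₚ.*-monoʳ-≤-nonNeg ∣ s n ∣ {{ℚₚ.∣-∣-nonNeg (s n)}} x≤ ⟩
       B * ∣ s n ∣           <⟨ *-monoˡ-< B 0<B s< ⟩
       B * (ε * r)           ≡⟨ cancel-reciprocal B r ε Br≡1 ⟩
       ε                     ∎)
     bounded (f (ε * r) (*-pos 0<ε 0<r))

pos-* : ∀ {s t} → Pos s → Pos t → Pos (λ n → s n * t n)
pos-* {s} {t} (ε , 0<ε , f) (δ , 0<δ , g) = ε * δ , *-pos 0<ε 0<δ , Eventually-zip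
  (λ n ε< δ< → ℚₚ.<-trans (*-monoˡ-< ε 0<ε δ<)
    (ℚₚ.*-monoˡ-<-pos (t n) {{positive (ℚₚ.<-trans 0<δ δ<)}} ε<)) f g

pos-+-null : ∀ {s t} → Pos s → Null t → Pos (λ n → s n + t n)
pos-+-null {s} {t} (ε , 0<ε , f) g = ε * ½ , half>0 0<ε , Eventually-zip
  (λ n ε<s t<ε/2 → begin-strict
    ε * ½                  ≡⟨ solve 2 (λ x y → x := x :+ y :- y) refl (ε * ½) (ε * ½) ⟩
    ε * ½ + ε * ½ - ε * ½  ≡⟨ cong (_- ε * ½) (halves ε) ⟩
    ε - ε * ½              <⟨ ℚₚ.+-mono-< ε<s (ℚₚ.neg-antimono-< (ℚₚ.≤-<-trans (-p≤∣p∣ (t n)) t<ε/2)) ⟩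
    s n + - - t n          ≡⟨ solve 2 (λ s t → s :+ :- (:- t) := s :+ t) refl (s n) (t n) ⟩
    s n + t n              ∎)
  f (g (ε * ½) (half>0 0<ε))

pos-const : ∀ {c} → 0ℚ < c → Pos (λ _ → c)
pos-const {c} 0<c = c * ½ , half>0 0<c , 0 , λ _ _ → subst (c * ½ <_) (halves c)
  (subst (_< c * ½ + c * ½) (ℚₚ.+-identityʳ _) (ℚₚ.+-monoʳ-< (c * ½) (half>0 0<c)))

null-cancel : ∀ {s t} → Pos s → Null (λ n → s n * t n) → Null t
null-cancel {s} {t} (δ , 0<δ , f) g ε 0<ε = Eventually-zip
  (λ n δ<s st<δε → ℚₚ.*-cancelˡ-<-nonNeg δ {{nonNegative (ℚₚ.<⇒≤ 0<δ)}} (begin-strict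
    δ * ∣ t n ∣       ≤⟨ ℚₚ.*-monoʳ-≤-nonNeg ∣ t n ∣ {{ℚₚ.∣-∣-nonNeg (t n)}} (ℚₚ.<⇒≤ (ℚₚ.<-≤-trans δ<s (p≤∣p∣ (s n)))) ⟩
    ∣ s n ∣ * ∣ t n ∣ ≡⟨ ℚₚ.∣p*q∣≡∣p∣*∣q∣ (s n) (t n) ⟨
    ∣ s n * t n ∣     <⟨ st<δε ⟩
    δ * ε             ∎))
  f (g (δ * ε) (*-pos 0<δ 0<ε))

<ᴿ⇒pos : ∀ {x y} → x <ᴿ y → Pos (λ n → seq y n - seq x n)
<ᴿ⇒pos {x} {y} (ε , 0<ε , f) = ε , 0<ε , Eventually-map
  (λ n h → subst (_< seq y n - seq x n) (shift (seq x n) ε) (ℚₚ.+-monoˡ-< (- seq x n) h)) f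
  where
  shift : ∀ x ε → x + ε - x ≡ ε
  shift = solve 2 (λ x ε → x :+ ε :- x := ε) refl

<ᴿ-trans : ∀ {x y z} → x <ᴿ y → y <ᴿ z → x <ᴿ z
<ᴿ-trans {x} {y} {z} (ε , 0<ε , f) (δ , 0<δ , g) = ε , 0<ε , Eventually-zip
  (λ n xy yz → ℚₚ.<-trans xy (ℚₚ.<-trans
    (subst (_< seq y n + δ) (ℚₚ.+-identityʳ _) (ℚₚ.+-monoʳ-< (seq y n) 0<δ)) yz)) f g

-- Rational stand-ins for a real point on either side of it, within η and with the same sign of `G`.
-- The margin κ becomes the positive gap that `_<ᴿ_` demands.
record Neighbourhood (G : ℚ → ℚ) (z : ℝ) (η : ℚ) : Set where
  field
    ℓ r κ : ℚ
    0<Gℓ  : 0ℚ < G ℓ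
    0<Gr  : 0ℚ < G r
    0<κ   : 0ℚ < κ
    ℓ+κ<z : Eventually (λ n → ℓ + κ < seq z n)
    z<ℓ+η : Eventually (λ n → seq z n < ℓ + η)
    z+κ<r : Eventually (λ n → seq z n + κ < r)
    r<z+η : Eventually (λ n → r < seq z n + η)

∣∣-split : ∀ p q r → ∣ p ∣ ≤ℚ ∣ p - q ∣ + (∣ q - r ∣ + ∣ r ∣)
∣∣-split p q r = begin
  ∣ p ∣                                ≡⟨ cong ∣_∣ (solve 3 (λ p q r → p := (p :- q) :+ ((q :- r) :+ r)) refl p q r) ⟩
  ∣ (p - q) + ((q - r) + r) ∣          ≤⟨ ℚₚ.∣p+q∣≤∣p∣+∣q∣ (p - q) ((q - r) + r) ⟩
  ∣ p - q ∣ + ∣ (q - r) + r ∣          ≤⟨ ℚₚ.+-monoʳ-≤ ∣ p - q ∣ (ℚₚ.∣p+q∣≤∣p∣+∣q∣ (q - r) r) ⟩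
  ∣ p - q ∣ + (∣ q - r ∣ + ∣ r ∣)      ∎

∣p-p∣≤ : ∀ {q} p → 0ℚ ≤ℚ q → ∣ p - p ∣ ≤ℚ q
∣p-p∣≤ {q} p 0≤q = subst (λ x → ∣ x ∣ ≤ℚ q) (sym (ℚₚ.+-inverseʳ p)) 0≤q

stays-positive : ∀ {p q ε} → ε < p → ∣ p - q ∣ ≤ℚ ε → 0ℚ < q
stays-positive {p} {q} {ε} ε<p ∣p-q∣≤ε = 0<q-p⇒p<q (begin-strict
  0ℚ               ≡⟨ ℚₚ.+-inverseʳ ε ⟨
  ε - ε            <⟨ ℚₚ.+-monoˡ-< (- ε) ε<p ⟩
  p - ε            ≤⟨ ℚₚ.+-monoʳ-≤ p (ℚₚ.neg-antimono-≤ (ℚₚ.≤-trans (p≤∣p∣ (p - q)) ∣p-q∣≤ε)) ⟩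
  p - (p - q)      ≡⟨ solve 2 (λ p q → p :- (p :- q) := q :- con 0ℚ) refl p q ⟩
  q - 0ℚ           ∎)

-- The centre ρ is a late approximation of z, with G ρ > ε and the tail of z within δ/2 of it. Since
-- L δ ≤ ε, `G` cannot reach 0 within distance δ of ρ.
ball : ∀ {G} → LocallyLipschitz G → ∀ z → Pos (G ∘ seq z) → ∀ η → 0ℚ < η →
       ∃[ ρ ] ∃[ δ ] 0ℚ < δ × δ ≤ℚ η × (∀ c → ∣ c - ρ ∣ ≤ℚ δ → 0ℚ < G c) ×
         Eventually (λ n → ∣ seq z n - ρ ∣ < δ * ½)
ball {G} lip z (ε , 0<ε , N₁ , ε<G) η 0<η =
  let N₀ , near  = cauchy z 1ℚ 0<1
      -- One unit is for the distance from ρ to `seq z N₀`, the other for the radius δ ≤ 1.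
      B          = 1ℚ + (1ℚ + ∣ seq z N₀ ∣)
      0≤B        = ℚₚ.<⇒≤ (+-pos 0<1 (ℚₚ.+-mono-<-≤ 0<1 (ℚₚ.0≤∣p∣ (seq z N₀))))
      L , 0<L , GL = lip B 0≤B
      r , 0<r , Lr≡1 = reciprocal L 0<L
      δ          = η ⊓ (1ℚ ⊓ (ε * r))
      0<δ        = ⊓-pos 0<η (⊓-pos 0<1 (*-pos 0<ε 0<r))
      K₀ , close = cauchy z (δ * ½) (half>0 0<δ)
      K          = N₀ ⊔ (N₁ ⊔ K₀)
  in choice N₀ near B refl 0≤B L (ℚₚ.<⇒≤ 0<L) GL δ 0<δ
       (ℚₚ.p⊓q≤p η (1ℚ ⊓ (ε * r)))
       (ℚₚ.≤-trans (ℚₚ.p⊓q≤q η (1ℚ ⊓ (ε * r))) (ℚₚ.p⊓q≤p 1ℚ (ε * r)))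
       (ℚₚ.≤-trans (*-monoˡ L (ℚₚ.<⇒≤ 0<L)
          (ℚₚ.≤-trans (ℚₚ.p⊓q≤q η (1ℚ ⊓ (ε * r))) (ℚₚ.p⊓q≤q 1ℚ (ε * r))))
          (ℚₚ.≤-reflexive (cancel-reciprocal L r ε Lr≡1)))
       K₀ close K (ℕₚ.m≤m⊔n N₀ (N₁ ⊔ K₀))
       (ℕₚ.≤-trans (ℕₚ.m≤m⊔n N₁ K₀) (ℕₚ.m≤n⊔m N₀ (N₁ ⊔ K₀)))
       (ℕₚ.≤-trans (ℕₚ.m≤n⊔m N₁ K₀) (ℕₚ.m≤n⊔m N₀ (N₁ ⊔ K₀)))
  where
  choice : ∀ N₀ → (∀ m n → N₀ ℕ.≤ m → N₀ ℕ.≤ n → ∣ seq z m - seq z n ∣ < 1ℚ) →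
    ∀ B → B ≡ 1ℚ + (1ℚ + ∣ seq z N₀ ∣) → 0ℚ ≤ℚ B → ∀ L → 0ℚ ≤ℚ L →
    (∀ x y → ∣ x ∣ ≤ℚ B → ∣ y ∣ ≤ℚ B → ∣ G x - G y ∣ ≤ℚ L * ∣ x - y ∣) →
    ∀ δ → 0ℚ < δ → δ ≤ℚ η → δ ≤ℚ 1ℚ → L * δ ≤ℚ ε →
    ∀ K₀ → (∀ m n → K₀ ℕ.≤ m → K₀ ℕ.≤ n → ∣ seq z m - seq z n ∣ < δ * ½) →
    ∀ K → N₀ ℕ.≤ K → N₁ ℕ.≤ K → K₀ ℕ.≤ K →
    ∃[ ρ ] ∃[ δ ] 0ℚ < δ × δ ≤ℚ η × (∀ c → ∣ c - ρ ∣ ≤ℚ δ → 0ℚ < G c) ×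
      Eventually (λ n → ∣ seq z n - ρ ∣ < δ * ½)
  choice N₀ near B refl 0≤B L 0≤L GL δ 0<δ δ≤η δ≤1 Lδ≤ε K₀ close K N₀≤K N₁≤K K₀≤K =
    ρ , δ , 0<δ , δ≤η , inside , K₀ , λ n K₀≤n → close n K K₀≤n K₀≤K
    where
    ρ = seq z K
    bounded : ∀ c → ∣ c - ρ ∣ ≤ℚ δ → ∣ c ∣ ≤ℚ B
    bounded c h = ℚₚ.≤-trans (∣∣-split c ρ (seq z N₀)) (ℚₚ.+-mono-≤ (ℚₚ.≤-trans h δ≤1)
      (ℚₚ.+-monoˡ-≤ ∣ seq z N₀ ∣ (ℚₚ.<⇒≤ (near K N₀ N₀≤K ℕₚ.≤-refl))))
    inside : ∀ c → ∣ c - ρ ∣ ≤ℚ δ → 0ℚ < G c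
    inside c h = stays-positive {G ρ} {G c} {ε} (ε<G K N₁≤K) (begin
      ∣ G ρ - G c ∣   ≤⟨ GL ρ c (bounded ρ (∣p-p∣≤ ρ (ℚₚ.<⇒≤ 0<δ))) (bounded c h) ⟩
      L * ∣ ρ - c ∣   ≤⟨ *-monoˡ L 0≤L (subst (_≤ℚ δ) (flip c ρ) h) ⟩
      L * δ           ≤⟨ Lδ≤ε ⟩
      ε               ∎)
      where
      flip : ∀ p q → ∣ p - q ∣ ≡ ∣ q - p ∣
      flip p q = trans (sym (ℚₚ.∣-p∣≡∣p∣ (p - q)))
        (cong ∣_∣ (solve 2 (λ p q → :- (p :- q) := q :- p) refl p q))

private
  0<h-p : ∀ {h p} → ∣ p ∣ < h → 0ℚ < h - p
  0<h-p {h} {p} c = 0<q-p (ℚₚ.≤-<-trans (p≤∣p∣ p) c)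

  0<h+p : ∀ {h p} → ∣ p ∣ < h → 0ℚ < h - - p
  0<h+p {h} {p} c = 0<q-p (ℚₚ.≤-<-trans (-p≤∣p∣ p) c)

  left-gap : ∀ z ρ h → ∣ z - ρ ∣ < h → ρ - (h + h) + h < z
  left-gap z ρ h c = 0<q-p⇒p<q (subst (0ℚ <_) (eq z ρ h) (0<h+p c))
    where
    eq : ∀ z ρ h → h - - (z - ρ) ≡ z - (ρ - (h + h) + h)
    eq = solve 3 (λ z ρ h → h :- (:- (z :- ρ)) := z :- (ρ :- (h :+ h) :+ h)) refl

  right-gap : ∀ z ρ h → ∣ z - ρ ∣ < h → z + h < ρ + (h + h)
  right-gap z ρ h c = 0<q-p⇒p<q (subst (0ℚ <_) (eq z ρ h) (0<h-p c))
    where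
    eq : ∀ z ρ h → h - (z - ρ) ≡ ρ + (h + h) - (z + h)
    eq = solve 3 (λ z ρ h → h :- (z :- ρ) := ρ :+ (h :+ h) :- (z :+ h)) refl

  left-close : ∀ z ρ h η → 0ℚ < h → h + h + (h + h) ≤ℚ η → ∣ z - ρ ∣ < h → z < ρ - (h + h) + η
  left-close z ρ h η 0<h 4h≤η c = 0<q-p⇒p<q (subst (0ℚ <_) (eq z ρ h η)
    (+-pos (ℚₚ.+-mono-<-≤ (0<h-p c) (0≤q-p 4h≤η)) 0<h))
    where
    eq : ∀ z ρ h η → h - (z - ρ) + (η - (h + h + (h + h))) + h ≡ ρ - (h + h) + η - z
    eq = solve 4 (λ z ρ h η → h :- (z :- ρ) :+ (η :- (h :+ h :+ (h :+ h))) :+ h :=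
                              ρ :- (h :+ h) :+ η :- z) refl

  right-close : ∀ z ρ h η → 0ℚ < h → h + h + (h + h) ≤ℚ η → ∣ z - ρ ∣ < h → ρ + (h + h) < z + η
  right-close z ρ h η 0<h 4h≤η c = 0<q-p⇒p<q (subst (0ℚ <_) (eq z ρ h η)
    (+-pos (ℚₚ.+-mono-<-≤ (0<h+p c) (0≤q-p 4h≤η)) 0<h))
    where
    eq : ∀ z ρ h η → h - - (z - ρ) + (η - (h + h + (h + h))) + h ≡ z + η - (ρ + (h + h))
    eq = solve 4 (λ z ρ h η → h :- (:- (z :- ρ)) :+ (η :- (h :+ h :+ (h :+ h))) :+ h :=
                              z :+ η :- (ρ :+ (h :+ h))) refl

  ∣ρ-w-ρ∣ : ∀ ρ w → 0ℚ ≤ℚ w → ∣ ρ - w - ρ ∣ ≡ w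
  ∣ρ-w-ρ∣ ρ w 0≤w = trans (cong ∣_∣ (solve 2 (λ ρ δ → ρ :- δ :- ρ := :- δ) refl ρ w))
                          (trans (ℚₚ.∣-p∣≡∣p∣ w) (ℚₚ.0≤p⇒∣p∣≡p 0≤w))

  ∣ρ+w-ρ∣ : ∀ ρ w → 0ℚ ≤ℚ w → ∣ ρ + w - ρ ∣ ≡ w
  ∣ρ+w-ρ∣ ρ w 0≤w = trans (cong ∣_∣ (solve 2 (λ ρ δ → ρ :+ δ :- ρ := δ) refl ρ w))
                          (ℚₚ.0≤p⇒∣p∣≡p 0≤w)

-- With h half the radius of the ball, the points are ρ - 2h and ρ + 2h. Late terms of z lie within
-- h of ρ, which leaves a margin h and a distance below 3h, while 4h ≤ η.
neighbourhood : ∀ {G} → LocallyLipschitz G → ∀ z → Pos (G ∘ seq z) → ∀ η → 0ℚ < η →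
                Neighbourhood G z η
neighbourhood {G} lip z posG η 0<η =
  let ρ , δ , 0<δ , δ≤η/2 , inside , close = ball lip z posG (η * ½) (half>0 0<η)
  in around ρ (δ * ½) (half>0 0<δ)
       (subst₂ _≤ℚ_ (sym (cong₂ _+_ (halves δ) (halves δ))) (halves η) (ℚₚ.+-mono-≤ δ≤η/2 δ≤η/2))
       (λ c h → inside c (subst (∣ c - ρ ∣ ≤ℚ_) (halves δ) h)) close
  where
  around : ∀ ρ h → 0ℚ < h → h + h + (h + h) ≤ℚ η → (∀ c → ∣ c - ρ ∣ ≤ℚ h + h → 0ℚ < G c) →
           Eventually (λ n → ∣ seq z n - ρ ∣ < h) → Neighbourhood G z η
  around ρ h 0<h 4h≤η inside close = record
    { ℓ = ρ - (h + h) ; r = ρ + (h + h) ; κ = h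
    ; 0<Gℓ  = inside (ρ - (h + h)) (ℚₚ.≤-reflexive (∣ρ-w-ρ∣ ρ (h + h) (ℚₚ.<⇒≤ (+-pos 0<h 0<h))))
    ; 0<Gr  = inside (ρ + (h + h)) (ℚₚ.≤-reflexive (∣ρ+w-ρ∣ ρ (h + h) (ℚₚ.<⇒≤ (+-pos 0<h 0<h))))
    ; 0<κ   = 0<h
    ; ℓ+κ<z = Eventually-map (λ n c → left-gap (seq z n) ρ h c) close
    ; z<ℓ+η = Eventually-map (λ n c → left-close (seq z n) ρ h η 0<h 4h≤η c) close
    ; z+κ<r = Eventually-map (λ n c → right-gap (seq z n) ρ h c) close
    ; r<z+η = Eventually-map (λ n c → right-close (seq z n) ρ h η 0<h 4h≤η c) close
    }

lipschitz-neg : ∀ {F} → LocallyLipschitz F → LocallyLipschitz (λ x → - F x)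
lipschitz-neg {F} f B 0≤B with f B 0≤B
... | L , 0<L , fL = L , 0<L , λ x y x≤ y≤ → subst (_≤ℚ L * ∣ x - y ∣)
  (trans (sym (ℚₚ.∣-p∣≡∣p∣ (F x - F y)))
    (cong ∣_∣ (solve 2 (λ a b → :- (a :- b) := :- a :- (:- b)) refl (F x) (F y))))
  (fL x y x≤ y≤)

private
  chain : ∀ r x h y ℓ η → h + h ≡ η → r < x + h → x + η < y → y < ℓ + h → r < ℓ
  chain r x h y ℓ _ refl rx xy yl = 0<q-p⇒p<q (subst (0ℚ <_) (eq r x h y ℓ)
    (+-pos (+-pos (0<q-p rx) (0<q-p xy)) (0<q-p yl)))
    where
    eq : ∀ r x h y ℓ → x + h - r + (y - (x + (h + h))) + (ℓ + h - y) ≡ ℓ - r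
    eq = solve 5 (λ r x h y ℓ → x :+ h :- r :+ (y :- (x :+ (h :+ h))) :+ (ℓ :+ h :- y) :=
                                ℓ :- r) refl

-- The signs are moved to a rational point right of x and one left of y, each within half the gap η,
-- so that these two stay in order. Bisection runs between them, and their margins from x and y make
-- both comparisons with the root strict.
intermediate-value : ∀ {G} → LocallyLipschitz G → ∀ x y → x <ᴿ y →
  Pos (G ∘ seq x) → Pos (λ n → - G (seq y n)) →
  ∃[ w ] x <ᴿ w × w <ᴿ y × Null (G ∘ seq w)
intermediate-value {G} lip x y (η , 0<η , x+η<y) posx negy =
  root ,
  (X.κ , X.0<κ , Eventually-map (λ n h → ℚₚ.<-≤-trans h (a≤root n)) X.z+κ<r) ,
  (Y.κ , Y.0<κ , Eventually-map (λ n h → ℚₚ.≤-<-trans (ℚₚ.+-monoˡ-≤ Y.κ (root≤b n)) h) Y.ℓ+κ<z) ,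
  root-null
  where
  module X = Neighbourhood (neighbourhood {G} lip x posx (η * ½) (half>0 0<η))
  module Y = Neighbourhood (neighbourhood {λ q → - G q} (lipschitz-neg {G} lip) y negy (η * ½) (half>0 0<η))
  separated : Eventually (λ _ → X.r < Y.ℓ)
  separated = Eventually-zip
    (λ n rx (xy , yl) → chain X.r (seq x n) (η * ½) (seq y n) Y.ℓ η (halves η) rx xy yl)
    X.r<z+η (Eventually-zip (λ _ → _,_) x+η<y Y.z<ℓ+η)
  Gℓ≤0 : G Y.ℓ ≤ℚ 0ℚ
  Gℓ≤0 = ℚₚ.<⇒≤ (0<q-p⇒p<q (subst (0ℚ <_) (sym (ℚₚ.+-identityˡ _)) Y.0<Gℓ))
  open Bisection G lip X.r Y.ℓ (proj₂ separated (proj₁ separated) ℕₚ.≤-refl) X.0<Gr Gℓ≤0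

-- Factorisation of real polynomials

coeff-+ₚ : ∀ p q i n → seq (coeff (p +ₚ q) i) n ≡ seq (coeff p i) n + seq (coeff q i) n
coeff-+ₚ []      q       i       n = sym (ℚₚ.+-identityˡ _)
coeff-+ₚ (a ∷ p) []      i       n = sym (ℚₚ.+-identityʳ _)
coeff-+ₚ (a ∷ p) (b ∷ q) zero    n = refl
coeff-+ₚ (a ∷ p) (b ∷ q) (suc i) n = coeff-+ₚ p q i n

coeff-·ₚ : ∀ c p i n → seq (coeff (c ·ₚ p) i) n ≡ seq c n * seq (coeff p i) n
coeff-·ₚ c []      i       n = sym (ℚₚ.*-zeroʳ (seq c n))
coeff-·ₚ c (a ∷ p) zero    n = refl
coeff-·ₚ c (a ∷ p) (suc i) n = coeff-·ₚ c p i n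

coeff-linear-zero : ∀ a b p n →
  seq (coeff ((a ∷ b ∷ []) *ₚ p) 0) n ≡ seq a n * seq (coeff p 0) n
coeff-linear-zero a b p n = trans (coeff-+ₚ (a ·ₚ p) _ 0 n)
  (trans (ℚₚ.+-identityʳ _) (coeff-·ₚ a p 0 n))

coeff-linear-suc : ∀ a b p i n → seq (coeff ((a ∷ b ∷ []) *ₚ p) (suc i)) n ≡
  seq a n * seq (coeff p (suc i)) n + seq b n * seq (coeff p i) n
coeff-linear-suc a b p i n = trans (coeff-+ₚ (a ·ₚ p) _ (suc i) n)
  (cong₂ _+_ (coeff-·ₚ a p (suc i) n) (trans (coeff-+ₚ (b ·ₚ p) _ i n)
    (trans (cong₂ _+_ (coeff-·ₚ b p i n) (coeff-0 i)) (ℚₚ.+-identityʳ _))))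
  where
  coeff-0 : ∀ i → seq (coeff (0ᴿ ∷ []) i) n ≡ 0ℚ
  coeff-0 zero    = refl
  coeff-0 (suc i) = refl

-- quotient x p is the quotient of a ∷ p by u - x, for any constant term a.
quotient : ℝ → Poly → Poly
quotient x []      = []
quotient x (b ∷ p) = eval (b ∷ p) x ∷ quotient x p

length-quotient : ∀ x p → length (quotient x p) ≡ length p
length-quotient x []      = refl
length-quotient x (b ∷ p) = cong suc (length-quotient x p)

top : ℝ → Poly → ℝ
top a []      = a
top a (b ∷ p) = top b p

top-quotient : ∀ x b p n →
  seq (top (eval (b ∷ p) x) (quotient x p)) n ≡ seq (top b p) n
top-quotient x b []      n = trans (cong (seq b n +_) (ℚₚ.*-zeroʳ (seq x n))) (ℚₚ.+-identityʳ _)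
top-quotient x b (c ∷ p) n = top-quotient x c p n

-- Exact for every approximation, whether or not x is a root: the remainder is the value at x, which
-- becomes null only when x is a root.
eval-division : ∀ x a p u n → seq (eval (a ∷ p) u) n ≡
  (seq u n - seq x n) * seq (eval (quotient x p) u) n + seq (eval (a ∷ p) x) n
eval-division x a []      u n =
  solve 3 (λ a u x → a :+ u :* con 0ℚ := (u :- x) :* con 0ℚ :+ (a :+ x :* con 0ℚ)) refl
    (seq a n) (seq u n) (seq x n)
eval-division x a (b ∷ p) u n = trans
  (cong (λ e → seq a n + seq u n * e) (eval-division x b p u n))
  (eq (seq a n) (seq u n) (seq x n) (seq (eval (quotient x p) u) n) (seq (eval (b ∷ p) x) n))
  where
  eq : ∀ a u x q e → a + u * ((u - x) * q + e) ≡ (u - x) * (e + u * q) + (a + x * e)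
  eq = solve 5 (λ a u x q e → a :+ u :* ((u :- x) :* q :+ e) :=
                              (u :- x) :* (e :+ u :* q) :+ (a :+ x :* e)) refl

quotient-zero : ∀ x p n → seq (coeff (quotient x p) 0) n ≡ seq (eval p x) n
quotient-zero x []      n = refl
quotient-zero x (b ∷ p) n = refl

coeff-division-zero : ∀ x a p n →
  seq a n ≡ - seq x n * seq (coeff (quotient x p) 0) n + seq (eval (a ∷ p) x) n
coeff-division-zero x a p n = trans (eq (seq a n) (seq x n) (seq (eval p x) n))
  (cong (λ e → - seq x n * e + seq (eval (a ∷ p) x) n) (sym (quotient-zero x p n)))
  where
  eq : ∀ a x e → a ≡ - x * e + (a + x * e)
  eq = solve 3 (λ a x e → a := :- x :* e :+ (a :+ x :* e)) refl

coeff-division-suc : ∀ x p i n → seq (coeff p i) n ≡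
  - seq x n * seq (coeff (quotient x p) (suc i)) n + 1ℚ * seq (coeff (quotient x p) i) n
coeff-division-suc x []      i       n =
  solve 1 (λ x → con 0ℚ := :- x :* con 0ℚ :+ con 1ℚ :* con 0ℚ) refl (seq x n)
coeff-division-suc x (b ∷ p) zero    n = trans (coeff-division-zero x b p n)
  (cong (- seq x n * seq (coeff (quotient x p) 0) n +_) (sym (ℚₚ.*-identityˡ _)))
coeff-division-suc x (b ∷ p) (suc i) n = coeff-division-suc x p i n

∏[_-_] : ∀ {d} → ℝ → Vec ℝ d → ℕ → ℚ
∏[ u - [] ]     n = 1ℚ
∏[ u - x ∷ xs ] n = (seq u n - seq x n) * ∏[ u - xs ] n

-- The order is kept as data because dividing by y - x for two roots requires them to be apart, see
-- `quotient-root`.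
data Between (lo hi : ℝ) : ∀ {d} → Vec ℝ d → Set where
  []  : lo <ᴿ hi → Between lo hi []
  _∷_ : ∀ {d x} {xs : Vec ℝ d} → lo <ᴿ x → Between x hi xs → Between lo hi (x ∷ xs)

all-above : ∀ {d lo hi} {xs : Vec ℝ d} → Between lo hi xs → VecAll.All (lo <ᴿ_) xs
all-above             ([] _)         = []
all-above {lo = lo} (_∷_ {x = x} lo<x bs) = lo<x ∷
  VecAll.map (λ {y} → <ᴿ-trans {lo} {x} {y} lo<x) (all-above bs)

-- Equality of coefficients is what `NonzeroRoots` asks for; equality of values is what transfers
-- signs in the induction.
IsFactorisation : ∀ {d} → ℝ → Poly → Vec ℝ d → Set
IsFactorisation a p xs =
  (∀ i → Null (λ n → seq (coeff (a ∷ p) i) n - seq (top a p) n * seq (coeff ∏[u- xs ] i) n)) ×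
  (∀ u → Null (λ n → seq (eval (a ∷ p) u) n - seq (top a p) n * ∏[ u - xs ] n))

-- The factorisation of the quotient is multiplied by u - x and the remainder, null because x is a
-- root, is added. Division by a monic factor keeps the leading coefficient.
factorise-step : ∀ {d} x a b p (xs : Vec ℝ d) → IsRoot (a ∷ b ∷ p) x →
  IsFactorisation (eval (b ∷ p) x) (quotient x p) xs → IsFactorisation a (b ∷ p) (x ∷ xs)
factorise-step x a b p xs root (coeffs , evals) = coeffs′ , evals′
  where
  p′ = a ∷ b ∷ p
  q  = quotient x (b ∷ p)
  remainder : Null (seq (eval p′ x))
  remainder = null-cong (λ n → ℚₚ.+-identityʳ _) root
  t = top b p
  top≡ = top-quotient x b p
  collect : ∀ x q r t π → - x * (q - t * π) + r ≡ - x * q + r - t * (- x * π)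
  collect = solve 5 (λ x q r t π → :- x :* (q :- t :* π) :+ r := :- x :* q :+ r :- t :* (:- x :* π)) refl
  collect₂ : ∀ x q q′ t π π′ → - x * (q - t * π) + (q′ - t * π′) ≡
                               - x * q + 1ℚ * q′ - t * (- x * π + 1ℚ * π′)
  collect₂ = solve 6 (λ x q q′ t π π′ → :- x :* (q :- t :* π) :+ (q′ :- t :* π′) :=
                :- x :* q :+ con 1ℚ :* q′ :- t :* (:- x :* π :+ con 1ℚ :* π′)) refl
  collect₃ : ∀ u x q r t π → (u + - x) * (q - t * π) + r ≡ (u - x) * q + r - t * ((u - x) * π)
  collect₃ = solve 6 (λ u x q r t π → (u :+ :- x) :* (q :- t :* π) :+ r :=
                (u :- x) :* q :+ r :- t :* ((u :- x) :* π)) refl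
  C Q : ℕ → ℕ → ℚ
  C i n = seq (coeff ∏[u- xs ] i) n
  Q i n = seq (coeff q i) n
  coeffs-q : ∀ i → Null (λ n → Q i n - seq t n * C i n)
  coeffs-q i = null-cong (λ n → cong (λ s → Q i n - s * C i n) (top≡ n)) (coeffs i)
  coeffs′ : ∀ i → Null (λ n → seq (coeff p′ i) n - seq t n * seq (coeff ∏[u- x ∷ xs ] i) n)
  coeffs′ zero    = null-cong
    (λ n → trans (collect (seq x n) (Q 0 n) (seq (eval p′ x) n) (seq t n) (C 0 n))
      (cong₂ (λ l r → l - seq t n * r) (sym (coeff-division-zero x a (b ∷ p) n))
        (sym (coeff-linear-zero (-ᴿ x) 1ᴿ ∏[u- xs ] n))))
    (null-+ (null-*ˡ (-ᴿ x) (coeffs-q 0)) remainder)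
  coeffs′ (suc i) = null-cong
    (λ n → trans (collect₂ (seq x n) (Q (suc i) n) (Q i n) (seq t n) (C (suc i) n) (C i n))
      (cong₂ (λ l r → l - seq t n * r) (sym (coeff-division-suc x (b ∷ p) i n))
        (sym (coeff-linear-suc (-ᴿ x) 1ᴿ ∏[u- xs ] i n))))
    (null-+ (null-*ˡ (-ᴿ x) (coeffs-q (suc i))) (coeffs-q i))
  evals′ : ∀ u → Null (λ n → seq (eval p′ u) n - seq t n * ∏[ u - x ∷ xs ] n)
  evals′ u = null-cong
    (λ n → trans (collect₃ (seq u n) (seq x n) (seq (eval q u) n) (seq (eval p′ x) n) (seq t n) (∏[ u - xs ] n))
      (cong (_- seq t n * ∏[ u - x ∷ xs ] n) (sym (eval-division x a (b ∷ p) u n))))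
    (null-+ (null-*ˡ (u +ᴿ -ᴿ x)
      (null-cong (λ n → cong (λ s → seq (eval q u) n - s * ∏[ u - xs ] n) (top≡ n)) (evals u))) remainder)

-- Subtracting the values at x and y leaves (y - x) q(y), and y - x is bounded away from 0.
quotient-root : ∀ x a p y → IsRoot (a ∷ p) x → x <ᴿ y → IsRoot (a ∷ p) y → IsRoot (quotient x p) y
quotient-root x a p y rx x<y ry = null-cong (λ n → sym (ℚₚ.+-identityʳ _))
  (null-cancel (<ᴿ⇒pos {x} {y} x<y) (null-cong difference (null-+ ry (null-neg rx))))
  where
  difference : ∀ n → seq (eval (a ∷ p) y) n - 0ℚ + - (seq (eval (a ∷ p) x) n - 0ℚ) ≡
                     (seq y n - seq x n) * seq (eval (quotient x p) y) n
  difference n = trans (cong (λ e → e - 0ℚ + - (seq (eval (a ∷ p) x) n - 0ℚ)) (eval-division x a p y n))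
    (eq ((seq y n - seq x n) * seq (eval (quotient x p) y) n) (seq (eval (a ∷ p) x) n))
    where
    eq : ∀ m r → m + r - 0ℚ + - (r - 0ℚ) ≡ m
    eq = solve 2 (λ m r → m :+ r :- con 0ℚ :+ :- (r :- con 0ℚ) := m) refl

factorise : ∀ {d lo hi} a p (xs : Vec ℝ d) → length p ≡ d → Between lo hi xs →
  VecAll.All (IsRoot (a ∷ p)) xs → IsFactorisation a p xs
factorise a []      []       refl _ _ = coeffs , λ u → null-cong (λ n → sym (eq₁ (seq a n) (seq u n))) null-0
  where
  eq₀ : ∀ a → a - a * 1ℚ ≡ 0ℚ
  eq₀ = solve 1 (λ a → a :- a :* con 1ℚ := con 0ℚ) refl
  eq₁ : ∀ a u → a + u * 0ℚ - a * 1ℚ ≡ 0ℚ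
  eq₁ = solve 2 (λ a u → a :+ u :* con 0ℚ :- a :* con 1ℚ := con 0ℚ) refl
  eq₂ : ∀ a → 0ℚ - a * 0ℚ ≡ 0ℚ
  eq₂ = solve 1 (λ a → con 0ℚ :- a :* con 0ℚ := con 0ℚ) refl
  coeffs : ∀ i → Null (λ n → seq (coeff (a ∷ []) i) n - seq a n * seq (coeff 1ₚ i) n)
  coeffs zero    = null-cong (λ n → sym (eq₀ (seq a n))) null-0
  coeffs (suc i) = null-cong (λ n → sym (eq₂ (seq a n))) null-0
factorise a (b ∷ p) (x ∷ xs) len (_ ∷ bs) (rx ∷ rxs) = factorise-step x a b p xs rx
  (factorise (eval (b ∷ p) x) (quotient x p) xs (trans (length-quotient x p) (ℕₚ.suc-injective len)) bs
    (VecAll.map (λ {y} (x<y , ry) → quotient-root x a (b ∷ p) y rx x<y ry)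
      (VecAll.zip (all-above bs , rxs))))

nonzeroRoots : ∀ {d lo} a p (xs : Vec ℝ d) → length p ≡ d → top a p # 0ᴿ →
  Between lo 0ᴿ xs → VecAll.All (_# 0ᴿ) xs → VecAll.All (IsRoot (a ∷ p)) xs →
  NonzeroRoots (0ᴿ ∷ a ∷ p) xs
nonzeroRoots a p xs len top# bs xs# roots = record
  { leading       = top a p
  ; leading#0     = top#
  ; multiplicity₀ = 1
  ; nonzero       = xs#
  ; factorisation = factors
  }
  where
  -- The coefficients of `(u- 0ᴿ) ^ₚ 1` exactly as `_*ₚ_` computes them, so that `coeff-linear-zero`
  -- and `coeff-linear-suc` apply.
  A B : ℝ
  A = -ᴿ 0ᴿ *ᴿ 1ᴿ +ᴿ 0ᴿ
  B = 1ᴿ *ᴿ 1ᴿ +ᴿ 0ᴿ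
  t = top a p
  Π = ∏[u- xs ]
  eq₀ : ∀ t π → 0ℚ ≡ 0ℚ - t * (0ℚ * π)
  eq₀ = solve 2 (λ t π → con 0ℚ := con 0ℚ :- t :* (con 0ℚ :* π)) refl
  eq₁ : ∀ c t π π′ → c - t * π ≡ c - t * (0ℚ * π′ + 1ℚ * π)
  eq₁ = solve 4 (λ c t π π′ → c :- t :* π := c :- t :* (con 0ℚ :* π′ :+ con 1ℚ :* π)) refl
  factors : 0ᴿ ∷ a ∷ p ≋ t ·ₚ ((u- 0ᴿ) ^ₚ 1 *ₚ Π)
  factors zero    = null-cong
    (λ n → trans (eq₀ (seq t n) (seq (coeff Π 0) n)) (cong (λ c → 0ℚ - c) (sym
      (trans (coeff-·ₚ t ((A ∷ B ∷ []) *ₚ Π) 0 n) (cong (seq t n *_) (coeff-linear-zero A B Π n))))))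
    null-0
  factors (suc i) = null-cong
    (λ n → trans (eq₁ (seq (coeff (a ∷ p) i) n) (seq t n) (seq (coeff Π i) n) (seq (coeff Π (suc i)) n))
      (cong (λ c → seq (coeff (a ∷ p) i) n - c) (sym
        (trans (coeff-·ₚ t ((A ∷ B ∷ []) *ₚ Π) (suc i) n) (cong (seq t n *_) (coeff-linear-suc A B Π i n))))))
    (proj₁ (factorise a p xs len bs roots) i)

-- Alternating signs and interlacing

sgn : ℕ → ℚ
sgn zero    = 1ℚ
sgn (suc d) = - sgn d

sgn² : ∀ d → sgn d * sgn d ≡ 1ℚ
sgn² zero    = refl
sgn² (suc d) = trans (solve 1 (λ s → :- s :* :- s := s :* s) refl (sgn d)) (sgn² d)

evalℚ : (ℕ → ℚ) → ℕ → ℚ → ℚ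
evalℚ c m u = TreeSeries.evalUpTo ℚₚ.+-*-commutativeRing u c m

eval-applyUpTo : ∀ (g : ℕ → ℕ) m x k →
  seq (eval (applyUpTo (λ i → fromℕ (g i)) m) x) k ≡ evalℚ (λ i → g i ℕ× 1ℚ) m (seq x k)
eval-applyUpTo g zero    x k = refl
eval-applyUpTo g (suc m) x k =
  cong₂ (λ a e → a + seq x k * e) (n/1≡n×1 (g 0)) (eval-applyUpTo (g ∘ suc) m x k)

top-applyUpTo : ∀ (g : ℕ → ℝ) m → top (g 0) (applyUpTo (g ∘ suc) m) ≡ g m
top-applyUpTo g zero    = refl
top-applyUpTo g (suc m) = top-applyUpTo (g ∘ suc) m

lipschitz-evalℚ : ∀ c m → LocallyLipschitz (evalℚ c m)
lipschitz-evalℚ c zero    = lipschitz-const 0ℚ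
lipschitz-evalℚ c (suc m) = lipschitz-+ {λ _ → c 0} {λ u → u * evalℚ (c ∘ suc) m u}
  (lipschitz-const (c 0))
  (lipschitz-* {λ u → u} {evalℚ (c ∘ suc) m} lipschitz-id (lipschitz-evalℚ (c ∘ suc) m))

-- Horner's scheme from the leading term: in c 0 + u g(u) the signed value of g is at least 1, and
-- -u ≥ 1 + |c 0| then absorbs c 0. The bound 1 in place of mere positivity keeps the induction
-- going.
sign-near--∞ : ∀ c m → 1ℚ ≤ℚ c m → ∃[ M ] (∀ u → u ≤ℚ M → 1ℚ ≤ℚ sgn m * evalℚ c (suc m) u)
sign-near--∞ c zero    1≤c = 0ℚ , λ u _ → subst (1ℚ ≤ℚ_) (eq (c 0) u) 1≤c
  where
  eq : ∀ c u → c ≡ 1ℚ * (c + u * 0ℚ)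
  eq = solve 2 (λ c u → c := con 1ℚ :* (c :+ u :* con 0ℚ)) refl
sign-near--∞ c (suc m) 1≤c with sign-near--∞ (c ∘ suc) m 1≤c
... | M , h = M ⊓ - (1ℚ + ∣ s * c 0 ∣) , bound
  where
  s = sgn m
  eq₁ : ∀ x y → x ≡ (x + y) * 1ℚ + - y
  eq₁ = solve 2 (λ x y → x := (x :+ y) :* con 1ℚ :+ :- y) refl
  eq₂ : ∀ s a u g → - u * (s * g) + - (s * a) ≡ - s * (a + u * g)
  eq₂ = solve 4 (λ s a u g → :- u :* (s :* g) :+ :- (s :* a) := :- s :* (a :+ u :* g)) refl
  bound : ∀ u → u ≤ℚ M ⊓ - (1ℚ + ∣ s * c 0 ∣) → 1ℚ ≤ℚ - s * evalℚ c (suc (suc m)) u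
  bound u u≤ = begin
    1ℚ                                         ≡⟨ eq₁ 1ℚ ∣ s * c 0 ∣ ⟩
    (1ℚ + ∣ s * c 0 ∣) * 1ℚ + - ∣ s * c 0 ∣
      ≤⟨ ℚₚ.+-mono-≤ (*-mono 0≤1+∣sc∣ (ℚₚ.≤-trans (ℚₚ.<⇒≤ 0<1) 1≤sg) large 1≤sg)
                     (ℚₚ.neg-antimono-≤ (p≤∣p∣ (s * c 0))) ⟩
    - u * (s * g) + - (s * c 0)                ≡⟨ eq₂ s (c 0) u g ⟩
    - s * (c 0 + u * g)                        ∎
    where
    g = evalℚ (c ∘ suc) (suc m) u
    1≤sg : 1ℚ ≤ℚ s * g
    1≤sg = h u (ℚₚ.≤-trans u≤ (ℚₚ.p⊓q≤p M (- (1ℚ + ∣ s * c 0 ∣))))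
    0≤1+∣sc∣ : 0ℚ ≤ℚ 1ℚ + ∣ s * c 0 ∣
    0≤1+∣sc∣ = ℚₚ.<⇒≤ (ℚₚ.+-mono-<-≤ 0<1 (ℚₚ.0≤∣p∣ (s * c 0)))
    large : 1ℚ + ∣ s * c 0 ∣ ≤ℚ - u
    large = subst (_≤ℚ - u) (solve 1 (λ x → :- (:- x) := x) refl (1ℚ + ∣ s * c 0 ∣))
      (ℚₚ.neg-antimono-≤ (ℚₚ.≤-trans u≤ (ℚₚ.p⊓q≤q M (- (1ℚ + ∣ s * c 0 ∣)))))

-- The sign at a point is (-1)^r, where r is the number of points to its right.
data Alternating (G : ℝ → ℕ → ℚ) : ∀ {d} → Vec ℝ d → Set where
  []  : Alternating G []
  _∷_ : ∀ {d x} {xs : Vec ℝ d} → Pos (λ n → sgn d * G x n) → Alternating G xs →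
        Alternating G (x ∷ xs)

Alternating-map : ∀ {P : ℝ → Set} {G H d} {xs : Vec ℝ d} →
  (∀ σ x → P x → Pos (λ n → σ * G x n) → Pos (λ n → σ * H x n)) →
  VecAll.All P xs → Alternating G xs → Alternating H xs
Alternating-map f []         []       = []
Alternating-map {P} {G} {H} {suc d} {x ∷ xs} f (px ∷ pxs) (a ∷ as) =
  f (sgn d) x px a ∷ Alternating-map {P} {G} {H} f pxs as

data Interlacing (lo hi : ℝ) : ∀ {d} → Vec ℝ d → Vec ℝ (suc d) → Set where
  last : ∀ {w} → lo <ᴿ w → w <ᴿ hi → Interlacing lo hi [] (w ∷ [])
  next : ∀ {d w x} {xs : Vec ℝ d} {ws} → lo <ᴿ w → w <ᴿ x → Interlacing x hi xs ws →
         Interlacing lo hi (x ∷ xs) (w ∷ ws)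

interlacing⇒alternate : ∀ {d lo hi} {xs : Vec ℝ d} {ws} → Interlacing lo hi xs ws → StrictlyAlternate xs ws
interlacing⇒alternate (next lo<w w<x (last x<w′ w′<hi))       fzero    = w<x , x<w′
interlacing⇒alternate (next lo<w w<x (next x<w′ w′<x′ inter)) fzero    = w<x , x<w′
interlacing⇒alternate (next lo<w w<x inter)                   (fsuc i) = interlacing⇒alternate inter i

interlacing⇒betweenˡ : ∀ {d lo hi} {xs : Vec ℝ d} {ws} → Interlacing lo hi xs ws → Between lo hi xs
interlacing⇒betweenˡ {lo = lo} {hi} (last {w} lo<w w<hi)       = [] (<ᴿ-trans {lo} {w} {hi} lo<w w<hi)
interlacing⇒betweenˡ {lo = lo} (next {w = w} {x} lo<w w<x inter) =
  <ᴿ-trans {lo} {w} {x} lo<w w<x ∷ interlacing⇒betweenˡ inter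

between-weaken : ∀ {d x y hi} {xs : Vec ℝ d} → x <ᴿ y → Between y hi xs → Between x hi xs
between-weaken {x = x} {y} {hi} x<y ([] y<hi)                = [] (<ᴿ-trans {x} {y} {hi} x<y y<hi)
between-weaken {x = x} {y}      x<y (_∷_ {x = z} y<z between) = <ᴿ-trans {x} {y} {z} x<y y<z ∷ between

interlacing⇒betweenʳ : ∀ {d lo hi} {xs : Vec ℝ d} {ws} → Interlacing lo hi xs ws → Between lo hi ws
interlacing⇒betweenʳ (last lo<w w<hi)      = lo<w ∷ [] w<hi
interlacing⇒betweenʳ (next lo<w w<x inter) = lo<w ∷ between-weaken w<x (interlacing⇒betweenʳ inter)

between-bounds : ∀ {d lo hi} {xs : Vec ℝ d} → Between lo hi xs → lo <ᴿ hi
between-bounds                ([] lo<hi)               = lo<hi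
between-bounds {lo = lo} {hi} (_∷_ {x = x} lo<x between) = <ᴿ-trans {lo} {x} {hi} lo<x (between-bounds between)

all-below : ∀ {d lo hi} {xs : Vec ℝ d} → Between lo hi xs → VecAll.All (_<ᴿ hi) xs
all-below ([] _)          = []
all-below (_ ∷ between)   = between-bounds between ∷ all-below between

-- Multiplying `F` by - (sgn d) makes it positive on the left and negative on the right; multiplying
-- once more recovers the root of `F`, as signs square to 1.
signed-root : ∀ d {F} → LocallyLipschitz F → ∀ x y → x <ᴿ y →
  Pos (λ n → sgn (suc d) * F (seq x n)) → Pos (λ n → sgn d * F (seq y n)) →
  ∃[ w ] x <ᴿ w × w <ᴿ y × Null (F ∘ seq w)
signed-root d {F} lip x y x<y posx posy =
  let w , x<w , w<y , root = intermediate-value {λ u → - s * F u}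
        (lipschitz-* {λ _ → - s} {F} (lipschitz-const (- s)) lip) x y x<y posx
        (pos-cong (λ n → eq₁ s (F (seq y n))) posy)
  in w , x<w , w<y , null-cong (λ n → trans (eq₂ s (F (seq w n)))
       (trans (cong (_* F (seq w n)) (sgn² d)) (ℚₚ.*-identityˡ _))) (null-*ˡ (fromℚ (- s)) root)
  where
  s = sgn d
  eq₁ : ∀ s f → s * f ≡ - (- s * f)
  eq₁ = solve 2 (λ s f → s :* f := :- (:- s :* f)) refl
  eq₂ : ∀ s f → - s * (- s * f) ≡ s * s * f
  eq₂ = solve 2 (λ s f → :- s :* (:- s :* f) := s :* s :* f) refl

-- If `hi` is counted among the points to the right, the sign of `F` at each of lo, xs and hi is
-- (-1)^r, so it changes between neighbours. The minus sign in `Alternating` accounts for counting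
-- `hi`.
interlacing-roots : ∀ {d F lo hi} {xs : Vec ℝ d} → LocallyLipschitz F → Between lo hi xs →
  Pos (λ n → sgn (suc d) * F (seq lo n)) → Alternating (λ x n → - F (seq x n)) xs →
  Pos (F ∘ seq hi) →
  ∃[ ws ] Interlacing lo hi xs ws × VecAll.All (λ w → Null (F ∘ seq w)) ws
interlacing-roots {F = F} {lo} {hi} lip ([] lo<hi) pos-lo [] pos-hi =
  let w , lo<w , w<hi , root = signed-root 0 {F} lip lo hi lo<hi pos-lo
        (pos-cong (λ n → sym (ℚₚ.*-identityˡ (F (seq hi n)))) pos-hi)
  in w ∷ [] , last lo<w w<hi , root ∷ []
interlacing-roots {suc d} {F} {lo} lip (_∷_ {x = x} lo<x between) pos-lo (pos-x ∷ signs) pos-hi =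
  let pos-x′ = pos-cong (λ n → eq (sgn d) (F (seq x n))) pos-x
      w , lo<w , w<x , root = signed-root (suc d) {F} lip lo x lo<x pos-lo pos-x′
      ws , inter , roots    = interlacing-roots {F = F} lip between pos-x′ signs pos-hi
  in w ∷ ws , next lo<w w<x inter , root ∷ roots
  where
  eq : ∀ s f → s * - f ≡ - s * f
  eq = solve 2 (λ s f → s :* (:- f) := :- s :* f) refl

∏-below : ∀ {d} w (xs : Vec ℝ d) → VecAll.All (w <ᴿ_) xs → Pos (λ n → sgn d * ∏[ w - xs ] n)
∏-below w []       []           = pos-const (subst (0ℚ <_) (sym (ℚₚ.*-identityˡ 1ℚ)) 0<1)
∏-below {suc d} w (x ∷ xs) (w<x ∷ w<xs) = pos-cong
  (λ n → eq (seq x n) (seq w n) (sgn d) (∏[ w - xs ] n))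
  (pos-* (<ᴿ⇒pos {w} {x} w<x) (∏-below w xs w<xs))
  where
  eq : ∀ x w s π → (x - w) * (s * π) ≡ - s * ((w - x) * π)
  eq = solve 4 (λ x w s π → (x :- w) :* (s :* π) := :- s :* ((w :- x) :* π)) refl

-- By interlacing, each w has as many of the xs to its right as it has later ws. In the recursion
-- the later ws exceed x, so the extra factor is positive there.
∏-alternating : ∀ {d lo hi} {xs : Vec ℝ d} {ws} → Interlacing lo hi xs ws →
                Alternating (λ w → ∏[ w - xs ]) ws
∏-alternating (last {w} _ _) = ∏-below w [] [] ∷ []
∏-alternating {xs = x ∷ xs} (next {w = w} _ w<x inter) =
  ∏-below w (x ∷ xs) (w<x ∷ VecAll.map (λ {y} → <ᴿ-trans {w} {x} {y} w<x) (all-above (interlacing⇒betweenˡ inter))) ∷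
  Alternating-map {x <ᴿ_} {λ w → ∏[ w - xs ]} {λ w → ∏[ w - x ∷ xs ]}
    (λ σ y x<y pos → pos-cong (λ n → eq (seq y n) (seq x n) σ (∏[ y - xs ] n)) (pos-* (<ᴿ⇒pos {x} {y} x<y) pos))
    (all-above (interlacing⇒betweenʳ inter)) (∏-alternating inter)
  where
  eq : ∀ y x σ π → (y - x) * (σ * π) ≡ σ * ((y - x) * π)
  eq = solve 4 (λ y x σ π → (y :- x) :* (σ :* π) := σ :* ((y :- x) :* π)) refl

-- Boolean-Narayana polynomials

coefficients : ℕ → ℕ → ℚ
coefficients n i = BoNa n (suc i) ℕ× 1ℚ

-- F n u = BoNa_n(u) / u
F : ℕ → ℚ → ℚ
F n = evalℚ (coefficients n) n

disc : ℚ → ℚ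
disc u = (1ℚ + u) * (1ℚ + u) - (u + u + u + u + u + u + u + u)

F-recurrence : ∀ n u → let ν = n ℕ× 1ℚ in
  (1ℚ + (1ℚ + ν) + 1ℚ) * - F (2 ℕ.+ n) u ≡
  ν * (disc u * F n u) + - (1ℚ + ν + (1ℚ + ν) + 1ℚ) * ((1ℚ + u) * F (1 ℕ.+ n) u)
F-recurrence n u = isolate ν (1ℚ + u) (u + u + u + u + u + u + u + u) (F (2 ℕ.+ n) u) (F (1 ℕ.+ n) u) (F n u) additive
  where
  open TreeSeries ℚₚ.+-*-commutativeRing u using (b; recurrence; evalUpTo-BoNa)
  ν = n ℕ× 1ℚ
  Additive : ℚ → ℚ → ℚ → ℚ → ℚ → ℚ → Set
  Additive ν p u8 f₂ f₁ f₀ = (1ℚ + (1ℚ + ν)) * f₂ + f₂ + p * (p * (ν * f₀)) ≡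
                             (p + p) * ((1ℚ + ν) * f₁) + u8 * (ν * f₀) + p * f₁
  isolate : ∀ ν p u8 f₂ f₁ f₀ → Additive ν p u8 f₂ f₁ f₀ →
    (1ℚ + (1ℚ + ν) + 1ℚ) * - f₂ ≡
    ν * ((p * p - u8) * f₀) + - (1ℚ + ν + (1ℚ + ν) + 1ℚ) * (p * f₁)
  isolate ν p u8 f₂ f₁ f₀ e = trans (eq₁ ν p f₂ f₀)
    (trans (cong (λ x → p * (p * (ν * f₀)) - x) e) (eq₂ ν p u8 f₁ f₀))
    where
    eq₁ : ∀ ν p f₂ f₀ → (1ℚ + (1ℚ + ν) + 1ℚ) * - f₂ ≡
      p * (p * (ν * f₀)) - ((1ℚ + (1ℚ + ν)) * f₂ + f₂ + p * (p * (ν * f₀)))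
    eq₁ = solve 4 (λ ν p f₂ f₀ → (con 1ℚ :+ (con 1ℚ :+ ν) :+ con 1ℚ) :* :- f₂ :=
      p :* (p :* (ν :* f₀)) :- ((con 1ℚ :+ (con 1ℚ :+ ν)) :* f₂ :+ f₂ :+ p :* (p :* (ν :* f₀)))) refl
    eq₂ : ∀ ν p u8 f₁ f₀ →
      p * (p * (ν * f₀)) - ((p + p) * ((1ℚ + ν) * f₁) + u8 * (ν * f₀) + p * f₁) ≡
      ν * ((p * p - u8) * f₀) + - (1ℚ + ν + (1ℚ + ν) + 1ℚ) * (p * f₁)
    eq₂ = solve 5 (λ ν p u8 f₁ f₀ →
      p :* (p :* (ν :* f₀)) :- ((p :+ p) :* ((con 1ℚ :+ ν) :* f₁) :+ u8 :* (ν :* f₀) :+ p :* f₁) :=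
      ν :* ((p :* p :- u8) :* f₀) :+ :- (con 1ℚ :+ ν :+ (con 1ℚ :+ ν) :+ con 1ℚ) :* (p :* f₁)) refl
  additive : Additive ν (1ℚ + u) (u + u + u + u + u + u + u + u) (F (2 ℕ.+ n) u) (F (1 ℕ.+ n) u) (F n u)
  additive = subst (λ f₀ → Additive ν (1ℚ + u) (u + u + u + u + u + u + u + u) (F (2 ℕ.+ n) u) (F (1 ℕ.+ n) u) f₀)
    (sym (evalUpTo-BoNa n))
    (subst₂ (λ f₂ f₁ → Additive ν (1ℚ + u) (u + u + u + u + u + u + u + u) f₂ f₁ (b n))
      (sym (evalUpTo-BoNa (2 ℕ.+ n))) (sym (evalUpTo-BoNa (1 ℕ.+ n))) (recurrence n))

0≤n×1 : ∀ n → 0ℚ ≤ℚ n ℕ× 1ℚ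
0≤n×1 zero    = ℚₚ.≤-refl
0≤n×1 (suc n) = ℚₚ.+-mono-≤ (ℚₚ.<⇒≤ 0<1) (0≤n×1 n)

0<1+n×1 : ∀ n → 0ℚ < suc n ℕ× 1ℚ
0<1+n×1 n = ℚₚ.+-mono-<-≤ 0<1 (0≤n×1 n)

1≤n×1 : ∀ {n} → 1 ≤ n → 1ℚ ≤ℚ n ℕ× 1ℚ
1≤n×1 {suc n} _ = subst (_≤ℚ suc n ℕ× 1ℚ) (ℚₚ.+-identityʳ 1ℚ) (ℚₚ.+-monoʳ-≤ 1ℚ (0≤n×1 n))

-- Here disc u - 1 = (-u) (6 - u). A uniform lower bound is needed, since `Pos` demands a fixed gap.
1≤disc : ∀ u → u < 0ℚ → 1ℚ ≤ℚ disc u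
1≤disc u u<0 = 0≤q-p⇒p≤q (subst (0ℚ ≤ℚ_) (eq u)
  (*-nonNeg 0≤-u (ℚₚ.+-mono-≤ (0≤n×1 6) 0≤-u)))
  where
  0≤-u : 0ℚ ≤ℚ - u
  0≤-u = ℚₚ.neg-antimono-≤ (ℚₚ.<⇒≤ u<0)
  eq : ∀ u → - u * (6 ℕ× 1ℚ + - u) ≡ disc u - 1ℚ
  eq = solve 1 (λ u → :- u :* (con (6 ℕ× 1ℚ) :+ :- u) :=
    (con 1ℚ :+ u) :* (con 1ℚ :+ u) :- (u :+ u :+ u :+ u :+ u :+ u :+ u :+ u) :- con 1ℚ) refl

disc-pos : ∀ x → x <ᴿ 0ᴿ → Pos (disc ∘ seq x)
disc-pos x (ε , 0<ε , h) = ½ , 0<½ , Eventually-map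
  (λ n x+ε<0 → ℚₚ.<-≤-trans ½<1 (1≤disc (seq x n) (ℚₚ.<-trans
    (subst (_< seq x n + ε) (ℚₚ.+-identityʳ _) (ℚₚ.+-monoʳ-< (seq x n) 0<ε)) x+ε<0))) h
  where
  ½<1 : ½ < 1ℚ
  ½<1 = 0<q-p⇒p<q 0<½

-- In `F-recurrence` the middle term is null at x, which leaves ν · disc · F (1 + d), to be divided
-- by the positive κ. The recurrence is used at index d + 1, so ν is positive.
sign-reversal : ∀ d σ x → x <ᴿ 0ᴿ → Null (F (2 ℕ.+ d) ∘ seq x) →
  Pos (λ n → σ * F (1 ℕ.+ d) (seq x n)) → Pos (λ n → σ * - F (3 ℕ.+ d) (seq x n))
sign-reversal d σ x x<0 root pos =
  let r , 0<r , κr≡1 = reciprocal κ 0<κ in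
  pos-cong (λ n → trans (cong (r *_) (step n)) (cancel r n κr≡1))
    (pos-* (pos-const 0<r)
      (pos-+-null (pos-* (pos-const (0<1+n×1 d)) (pos-* (disc-pos x x<0) pos))
        (null-*ˡ (fromℚ (- (σ * μ))) (null-*ˡ (1ᴿ +ᴿ x) root))))
  where
  ν = suc d ℕ× 1ℚ
  κ = 1ℚ + (1ℚ + ν) + 1ℚ
  μ = 1ℚ + ν + (1ℚ + ν) + 1ℚ
  0<κ : 0ℚ < κ
  0<κ = +-pos (+-pos 0<1 (+-pos 0<1 (0<1+n×1 d))) 0<1
  step : ∀ n → let u = seq x n in
    ν * (disc u * (σ * F (1 ℕ.+ d) u)) + - (σ * μ) * ((1ℚ + u) * F (2 ℕ.+ d) u) ≡
    σ * (κ * - F (3 ℕ.+ d) u)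
  step n = trans (eq ν (disc (seq x n)) σ (F (1 ℕ.+ d) (seq x n)) μ ((1ℚ + seq x n) * F (2 ℕ.+ d) (seq x n)))
    (cong (σ *_) (sym (F-recurrence (suc d) (seq x n))))
    where
    eq : ∀ ν q σ f μ g → ν * (q * (σ * f)) + - (σ * μ) * g ≡ σ * (ν * (q * f) + - μ * g)
    eq = solve 6 (λ ν q σ f μ g → ν :* (q :* (σ :* f)) :+ :- (σ :* μ) :* g :=
                                  σ :* (ν :* (q :* f) :+ :- μ :* g)) refl
  cancel : ∀ r n → κ * r ≡ 1ℚ → r * (σ * (κ * - F (3 ℕ.+ d) (seq x n))) ≡ σ * - F (3 ℕ.+ d) (seq x n)
  cancel r n e = trans (eq r σ κ (- F (3 ℕ.+ d) (seq x n)))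
    (trans (cong (_* (σ * - F (3 ℕ.+ d) (seq x n))) e) (ℚₚ.*-identityˡ _))
    where
    eq : ∀ r σ κ f → r * (σ * (κ * f)) ≡ κ * r * (σ * f)
    eq = solve 4 (λ r σ κ f → r :* (σ :* (κ :* f)) := κ :* r :* (σ :* f)) refl

-- Positivity of the extreme coefficients

∈⇒1≤length : ∀ {A : Set} {x : A} {xs} → x ∈ xs → 1 ≤ length xs
∈⇒1≤length (here _)  = s≤s z≤n
∈⇒1≤length (there _) = s≤s z≤n

-- Paths without right edges witness the constant term of `F`, hence its sign at 0; paths with only
-- right edges witness the leading coefficient, hence its sign near -∞.
leftPath rightPath : ℕ → ZeroOneTree
leftPath zero     = leaf
leftPath (suc m)  = left (leftPath m)
rightPath zero    = leaf
rightPath (suc m) = right (rightPath m)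

leftPath-shape : ∀ m → HasShape (suc m) 1 (leftPath m)
leftPath-shape zero    = refl , refl
leftPath-shape (suc m) = cong suc (proj₁ (leftPath-shape m)) , proj₂ (leftPath-shape m)

rightPath-shape : ∀ m → HasShape (suc m) (suc m) (rightPath m)
rightPath-shape zero    = refl , refl
rightPath-shape (suc m) = cong suc (proj₁ (rightPath-shape m)) , cong suc (proj₂ (rightPath-shape m))

1≤BoNa-first : ∀ m → 1 ≤ BoNa (suc m) 1
1≤BoNa-first m = ∈⇒1≤length (zeroOneTrees-complete (leftPath-shape m))

1≤BoNa-last : ∀ m → 1 ≤ BoNa (suc m) (suc m)
1≤BoNa-last m = ∈⇒1≤length (zeroOneTrees-complete (rightPath-shape m))

-- Induction on the number of nonzero roots

constantTerm : ℕ → ℝ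
constantTerm m = fromℕ (BoNa (suc m) 1)

higherTerms : ℕ → Poly
higherTerms m = applyUpTo (λ i → fromℕ (BoNa (suc m) (2 ℕ.+ i))) m

top≡ : ∀ m → top (constantTerm m) (higherTerms m) ≡ fromℕ (BoNa (suc m) (suc m))
top≡ m = top-applyUpTo (λ i → fromℕ (BoNa (suc m) (suc i))) m

eval≡F : ∀ m x n → seq (eval (constantTerm m ∷ higherTerms m) x) n ≡ F (suc m) (seq x n)
eval≡F m x n = eval-applyUpTo (λ i → BoNa (suc m) (suc i)) (suc m) x n

-- The induction invariant. `signs` replaces the roots of the preceding polynomial: its signs at the
-- present roots are all that the recurrence uses. The lower bound is rational so that it can be
-- decreased by a minimum.
record Roots (d : ℕ) : Set where
  field
    lower   : ℚ
    roots   : Vec ℝ d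
    between : Between (fromℚ lower) 0ᴿ roots
    isRoot  : VecAll.All (λ x → Null (F (suc d) ∘ seq x)) roots
    signs   : Alternating (λ x n → F d (seq x n)) roots
open Roots

isRoots : ∀ {d} (R : Roots d) → VecAll.All (IsRoot (constantTerm d ∷ higherTerms d)) (roots R)
isRoots {d} R = VecAll.map
  (λ {x} → null-cong (λ n → trans (sym (eval≡F d x n)) (sym (ℚₚ.+-identityʳ _)))) (isRoot R)

0<top : ∀ m → 0ℚ < seq (top (constantTerm m) (higherTerms m)) 0
0<top m = subst (λ t → 0ℚ < seq t 0) (sym (top≡ m)) (subst (0ℚ <_) (sym (n/1≡n×1 (BoNa (suc m) (suc m))))
  (ℚₚ.<-≤-trans 0<1 (1≤n×1 (1≤BoNa-last m))))

pos-top : ∀ m → Pos (seq (top (constantTerm m) (higherTerms m)))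
pos-top m = subst (λ t → Pos (seq t)) (sym (top≡ m)) (pos-const (subst (λ t → 0ℚ < seq t 0) (top≡ m) (0<top m)))

roots-interlacing : ∀ {d} (R : Roots d) → ∃[ R′ ] Interlacing (fromℚ (lower R′)) 0ᴿ (roots R) (roots {suc d} R′)
roots-interlacing {d} R = record
  { lower   = lo
  ; roots   = ws
  ; between = interlacing⇒betweenʳ inter
  ; isRoot  = ws-roots
  ; signs   = Alternating-map {λ _ → ⊤} {λ w → ∏[ w - roots R ]} {λ w n → F (suc d) (seq w n)}
                (λ σ w _ → same-sign σ w) (VecAll.universal (λ _ → tt) ws) (∏-alternating inter)
  } , inter
  where
  near-∞ = sign-near--∞ (coefficients (2 ℕ.+ d)) (suc d) (1≤n×1 (1≤BoNa-last (suc d)))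
  M = proj₁ near-∞
  -- Below the present roots, and low enough for the leading term to determine the sign of
  -- `F (2 + d)`.
  lo = lower R ⊓ M
  relower : ∀ {a b d} {xs : Vec ℝ d} → b ≤ℚ a → Between (fromℚ a) 0ᴿ xs → Between (fromℚ b) 0ᴿ xs
  relower b≤a ([] (ε , 0<ε , N , h)) = [] (ε , 0<ε , N , λ n N≤n → ℚₚ.≤-<-trans (ℚₚ.+-monoˡ-≤ ε b≤a) (h n N≤n))
  relower b≤a ((ε , 0<ε , N , h) ∷ between) =
    (ε , 0<ε , N , λ n N≤n → ℚₚ.≤-<-trans (ℚₚ.+-monoˡ-≤ ε b≤a) (h n N≤n)) ∷ between
  between′ : Between (fromℚ lo) 0ᴿ (roots R)
  between′ = relower (ℚₚ.p⊓q≤p (lower R) M) (between R)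
  pos-lo : Pos (λ _ → sgn (suc d) * F (2 ℕ.+ d) lo)
  pos-lo = pos-const (ℚₚ.<-≤-trans 0<1 (proj₂ near-∞ lo (ℚₚ.p⊓q≤q (lower R) M)))
  pos-0 : Pos (λ _ → F (2 ℕ.+ d) 0ℚ)
  pos-0 = pos-const (subst (0ℚ <_) (eq (coefficients (2 ℕ.+ d) 0) (evalℚ (coefficients (2 ℕ.+ d) ∘ suc) (suc d) 0ℚ))
    (ℚₚ.<-≤-trans 0<1 (1≤n×1 (1≤BoNa-first (suc d)))))
    where
    eq : ∀ c g → c ≡ c + 0ℚ * g
    eq = solve 2 (λ c g → c := c :+ con 0ℚ :* g) refl
  -- For d = 0 there is no point to check; for larger d the index in `sign-reversal` drops by one.
  reversed : ∀ {d} (R : Roots d) → Alternating (λ x n → - F (2 ℕ.+ d) (seq x n)) (roots R)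
  reversed {zero}  R with roots R
  ... | [] = []
  reversed {suc d} R = Alternating-map {λ x → x <ᴿ 0ᴿ × Null (F (2 ℕ.+ d) ∘ seq x)}
    {λ x n → F (suc d) (seq x n)} {λ x n → - F (3 ℕ.+ d) (seq x n)}
    (λ σ x (x<0 , root) → sign-reversal d σ x x<0 root)
    (VecAll.zip (all-below (between R) , isRoot R)) (signs R)
  new = interlacing-roots {F = F (2 ℕ.+ d)} {fromℚ lo} {0ᴿ} (lipschitz-evalℚ (coefficients (2 ℕ.+ d)) (2 ℕ.+ d))
    between′ pos-lo (reversed R) pos-0
  ws = proj₁ new
  inter = proj₁ (proj₂ new)
  ws-roots = proj₂ (proj₂ new)
  t = top (constantTerm d) (higherTerms d)
  same-sign : ∀ σ w → Pos (λ n → σ * ∏[ w - roots R ] n) → Pos (λ n → σ * F (suc d) (seq w n))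
  -- At w the value of `F (suc d)` differs from its leading coefficient times the product by a null
  -- sequence, and so inherits the sign of the product. This yields `signs` for the next stage.
  same-sign σ w pos = pos-cong
    (λ n → trans (eq (seq t n) σ (∏[ w - roots R ] n) (seq (eval p w) n)) (cong (σ *_) (eval≡F d w n)))
    (pos-+-null (pos-* (pos-top d) pos) (null-*ˡ (fromℚ σ)
      (proj₂ (factorise (constantTerm d) (higherTerms d) (roots R) (length-applyUpTo _ d) (between R) (isRoots R)) w)))
    where
    p = constantTerm d ∷ higherTerms d
    eq : ∀ t σ π f → t * (σ * π) + σ * (f - t * π) ≡ σ * f
    eq = solve 4 (λ t σ π f → t :* (σ :* π) :+ σ :* (f :- t :* π) := σ :* f) refl

rootsOf : ∀ d → Roots d
-- `F 1` is constant and has no roots; -1 is an arbitrary negative bound.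
rootsOf zero    = record
  { lower = - 1ℚ ; roots = [] ; isRoot = [] ; signs = []
  ; between = [] (½ , 0<½ , 0 , λ _ _ → 0<q-p⇒p<q 0<½) }
rootsOf (suc d) = proj₁ (roots-interlacing (rootsOf d))

pos⇒0<ᴿ : ∀ x → Pos (seq x) → 0ᴿ <ᴿ x
pos⇒0<ᴿ x (ε , 0<ε , h) = ε , 0<ε ,
  Eventually-map (λ n → subst (_< seq x n) (sym (ℚₚ.+-identityˡ ε))) h

nonzeroRoots-BoNa : ∀ {d} (R : Roots d) → NonzeroRoots (BoNaPoly (suc d)) (roots R)
nonzeroRoots-BoNa {d} R = nonzeroRoots (constantTerm d) (higherTerms d) (roots R)
  (length-applyUpTo _ d) (inj₂ (pos⇒0<ᴿ (top (constantTerm d) (higherTerms d)) (pos-top d))) (between R)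
  (VecAll.map inj₁ (all-below (between R))) (isRoots R)

theorem5p4 : (n : ℕ) → 2 ≤ n →
    IsRoot (BoNaPoly n) 0ᴿ ×
    NonzeroRootsStrictlyInterlace (n ∸ 2) (BoNaPoly (n ∸ 1)) (BoNaPoly n)
theorem5p4 n@(suc (suc d)) (s≤s (s≤s z≤n)) =
  null-cong (λ k → eq (seq (eval (constantTerm (suc d) ∷ higherTerms (suc d)) 0ᴿ) k)) null-0 ,
  -- `Roots d` concerns `BoNaPoly (suc d)`, whose root at 0 is split off; with n = d + 2 this is the
  -- polynomial of index n - 1.
  let R = rootsOf d
      R′ , inter = roots-interlacing R
  in roots R , roots R′ , nonzeroRoots-BoNa R , nonzeroRoots-BoNa R′ , interlacing⇒alternate inter
  where
  eq : ∀ e → 0ℚ ≡ 0ℚ + 0ℚ * e - 0ℚ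
  eq = solve 1 (λ e → con 0ℚ := con 0ℚ :+ con 0ℚ :* e :- con 0ℚ) refl
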